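{- Let $M$ be a matroid of rank $r$ on a finite set $E$, and let $P_{\mathcal F(M)}$ be the polytope of its truncation flag matroid. Then, as a signed Minkowski sum, \[P_{\mathcal F(M)}=\sum_{I\subseteq E}\widetilde\gamma(M/I)\,\Delta_{E-I},\] i.e. $P_{\mathcal F(M)}+\sum_{I:\,\widetilde\gamma(M/I)<0}(-\widetilde\gamma(M/I))\Delta_{E-I}=\sum_{I:\,\widetilde\gamma(M/I)>0}\widetilde\gamma(M/I)\Delta_{E-I}$.
   Context: For $1\le i\le r$, the rank-$i$ truncation $M_i$ of $M$ is the matroid on $E$ whose bases are the independent sets of $M$ of size $i$. The truncation flag matroid $\mathcal F(M)$ is the set of flags $B=(B_1,\dots,B_r)$ with $B_i$ a basis of $M_i$ and $B_1\subset B_2\subset\cdots\subset B_r$. For such a flag let $v_B=v_{B_1}+\cdots+v_{B_r}$, where $v_S=\sum_{a\in S}e_a\in\mathbb{R}^E$; then $P_{\mathcal F(M)}=\mathrm{conv}\{v_B: B\in\mathcal F(M)\}$. For nonempty $J\subseteq E$, $\Delta_J=\mathrm{conv}\{e_i:i\in J\}$. For $I\subseteq E$, $M/I$ is the contraction with rank function $r_{M/I}(X)=r(X\cup I)-r(I)$. For a matroid $N$ with Tutte polynomial $T_N(x,y)=\sum_{A}(x-1)^{r_N(S)-r_N(A)}(y-1)^{|A|-r_N(A)}=\sum b_{ij}x^iy^j$, the gamma invariant is $\gamma(N)=b_{20}-b_{10}$ and the signed gamma invariant is $\widetilde\gamma(N)=(-1)^{r_N(S)}\gamma(N)$, where $S$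 is the ground set of $N$. Minkowski sum $P+Q=\{p+q\}$, $yQ=\{yq\}$ for $y\ge0$.
   Formalization: The polytopes are taken as sets of points of ℚ^E, with rational weights in the convex hulls, instead of ℝ^E; since all vertices and coefficients are integers, the equality in ℝ^E follows by comparing vertices. -}

module Defs where

open import Data.Nat as ℕ using (ℕ; zero; suc; _∸_; _≤_; _<_)
open import Data.Integer as ℤ using (ℤ; +_; -_)
open import Data.Rational as ℚ using (ℚ; 0ℚ; 1ℚ; _≤_)
open import Data.Fin using (Fin; toℕ) renaming (zero to fzero; suc to fsuc)
open import Data.Fin.Subset using (Subset; _⊆_; _⊂_; _∪_; _∩_; ∁; ∣_∣; ⊤; Nonempty; _∈_; inside; outside)
open import Data.Fin.Subset.Properties using (_⊆?_; nonempty?)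
open import Data.Vec using (Vec; []; _∷_; lookup)
open import Data.List using (List; []; _∷_; _++_; map; filter; foldr)
open import Data.Product using (Σ; ∃; _×_; _,_)
open import Data.Bool using (if_then_else_)
open import Relation.Binary.PropositionalEquality using (_≡_)

allSubsets : (n : ℕ) → List (Subset n)
allSubsets zero = [] ∷ []
allSubsets (suc n) = map (inside ∷_) (allSubsets n) ++ map (outside ∷_) (allSubsets n)

subsetsOf : ∀ {n} → Subset n → List (Subset n)
subsetsOf {n} S = filter (_⊆? S) (allSubsets n)

record Matroid (n : ℕ) : Set where
  field
    rk        : Subset n → ℕ
    rk-bound  : ∀ X → rk X ℕ.≤ ∣ X ∣
    rk-mono   : ∀ {X Y} → X ⊆ Y → rk X ℕ.≤ rk Y
    rk-submod : ∀ X Y → rk (X ∪ Y) ℕ.+ rk (X ∩ Y) ℕ.≤ rk X ℕ.+ rk Y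
open Matroid public

rank : ∀ {n} → Matroid n → ℕ
rank M = rk M ⊤

Independent : ∀ {n} → Matroid n → Subset n → Set
Independent M X = rk M X ≡ ∣ X ∣

-- A "matroid-like" datum on a ground subset S ⊆ Fin n (used for minors):
-- ground set and rank function on subsets of Fin n.

record RankData (n : ℕ) : Set where
  field
    ground : Subset n
    rkD    : Subset n → ℕ
open RankData public

asRankData : ∀ {n} → Matroid n → RankData n
asRankData M = record { ground = ⊤ ; rkD = rk M }

contract : ∀ {n} → Matroid n → Subset n → RankData n
contract M I = record { ground = ∁ I ; rkD = λ X → rk M (X ∪ I) ∸ rk M I }

-- Bivariate integer polynomials, as coefficient functions
-- (p i j = coefficient of x^i y^j)

Poly2 : Set
Poly2 = ℕ → ℕ → ℤ

0P 1P X Y : Poly2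
0P i j = + 0
1P zero zero = + 1
1P _ _ = + 0
X (suc zero) zero = + 1
X _ _ = + 0
Y zero (suc zero) = + 1
Y _ _ = + 0

_+P_ _-P_ : Poly2 → Poly2 → Poly2
(p +P q) i j = p i j ℤ.+ q i j
(p -P q) i j = p i j ℤ.- q i j

sumTo : ℕ → (ℕ → ℤ) → ℤ
sumTo zero f = f zero
sumTo (suc k) f = sumTo k f ℤ.+ f (suc k)

_*P_ : Poly2 → Poly2 → Poly2
(p *P q) i j = sumTo i λ a → sumTo j λ b → p a b ℤ.* q (i ∸ a) (j ∸ b)

_^P_ : Poly2 → ℕ → Poly2
p ^P zero = 1P
p ^P suc k = p *P (p ^P k)

sumP : List Poly2 → Poly2
sumP = foldr _+P_ 0P

tutte : ∀ {n} → RankData n → Poly2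
tutte N = sumP (map term (subsetsOf (ground N)))
  where
  term : _ → Poly2
  term A = ((X -P 1P) ^P (rkD N (ground N) ∸ rkD N A))
        *P ((Y -P 1P) ^P (∣ A ∣ ∸ rkD N A))

gamma : ∀ {n} → RankData n → ℤ
gamma N = tutte N 2 0 ℤ.- tutte N 1 0

signedGamma : ∀ {n} → RankData n → ℤ
signedGamma N = sgn (rkD N (ground N)) ℤ.* gamma N
  where
  sgn : ℕ → ℤ
  sgn zero = + 1
  sgn (suc k) = - (sgn k)

Pt : ℕ → Set
Pt n = Fin n → ℚ

_≈_ : ∀ {n} → Pt n → Pt n → Set
p ≈ q = ∀ i → p i ≡ q i

0v : ∀ {n} → Pt n
0v i = 0ℚ

_+v_ : ∀ {n} → Pt n → Pt n → Pt n
(p +v q) i = p i ℚ.+ q i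

_·v_ : ∀ {n} → ℚ → Pt n → Pt n
(c ·v p) i = c ℚ.* p i

indicator : ∀ {n} → Subset n → Pt n
indicator S i = if lookup S i then 1ℚ else 0ℚ

sumW : ∀ {n} → List (ℚ × Pt n) → Pt n
sumW = foldr (λ { (c , v) acc → (c ·v v) +v acc }) 0v

sumC : ∀ {n} → List (ℚ × Pt n) → ℚ
sumC = foldr (λ { (c , v) acc → c ℚ.+ acc }) 0ℚ

data AllL {A : Set} (P : A → Set) : List A → Set where
  []  : AllL P []
  _∷_ : ∀ {x xs} → P x → AllL P xs → AllL P (x ∷ xs)

conv : ∀ {n} → (Pt n → Set) → Pt n → Set
conv {n} V p = Σ (List (ℚ × Pt n)) λ ws →
    AllL (λ { (c , v) → (0ℚ ℚ.≤ c) × V v }) ws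
  × sumC ws ≡ 1ℚ
  × p ≈ sumW ws

scale : ∀ {n} → ℚ → (Pt n → Set) → Pt n → Set
scale y Q p = Σ _ λ q → Q q × p ≈ (y ·v q)

minkSum : ∀ {n} → List (Pt n → Set) → Pt n → Set
minkSum [] p = p ≈ 0v
minkSum (Q ∷ Qs) p = Σ _ λ q → Σ _ λ q' → Q q × minkSum Qs q' × p ≈ (q +v q')

simplex : ∀ {n} → Subset n → Pt n → Set
simplex J = conv (λ v → Σ _ λ j → j ∈ J × v ≈ indicator (Data.Fin.Subset.⁅ j ⁆))

-- a flag (B_1 ⊂ ... ⊂ B_r), B_i (i = toℕ k + 1) a basis of the truncation M_i,
-- i.e. an independent set of M of size i
IsFlag : ∀ {n} (M : Matroid n) → (Fin (rank M) → Subset n) → Set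
IsFlag M B =
    (∀ k → Independent M (B k) × ∣ B k ∣ ≡ suc (toℕ k))
  × (∀ k l → toℕ l ≡ suc (toℕ k) → B k ⊂ B l)

flagVec : ∀ {n} (M : Matroid n) → (Fin (rank M) → Subset n) → Pt n
flagVec M B = go (rank M) B
  where
  go : (m : ℕ) → (Fin m → Subset _) → Pt _
  go zero B = 0v
  go (suc m) B = indicator (B fzero) +v go m (λ k → B (fsuc k))

flagPolytope : ∀ {n} → Matroid n → Pt n → Set
flagPolytope M = conv (λ v → Σ _ λ B → IsFlag M B × v ≈ flagVec M B)

properSubsets : (n : ℕ) → List (Subset n)
properSubsets n = filter (λ I → nonempty? (∁ I)) (allSubsets n)

posPart negPart : ℤ → ℚ
posPart (+ k) = (+ k) ℚ./ 1
posPart ℤ.-[1+ k ] = 0ℚ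
negPart (+ k) = 0ℚ
negPart ℤ.-[1+ k ] = (+ suc k) ℚ./ 1

positiveTerms negativeTerms : ∀ {n} → Matroid n → List (Pt n → Set)
positiveTerms {n} M =
  map (λ I → scale (posPart (signedGamma (contract M I))) (simplex (∁ I)))
      (properSubsets n)
negativeTerms {n} M =
  map (λ I → scale (negPart (signedGamma (contract M I))) (simplex (∁ I)))
      (properSubsets n)

{-# OPTIONS --safe #-}
-- Both sides are base polytopes { x : x(A) ≤ f(A) for all A, x(E) = f(E) } of submodular functions f, so it
-- suffices to compare the functions. By Edmonds' theorem such a polytope is the convex hull of its greedy
-- points, one for each ordering of E, and greedy points are additive in f; hence a Minkowski sum of base
-- polytopes is the base polytope of the sum. The simplex Δ_J has f(A) = [A ∩ J ≠ ∅], and the flag polytope has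
-- f(A) = Σ_{k ≤ r} min(k, r(A)) = C(r+1, 2) - C(r-r(A)+1, 2), its greedy points being the flag vectors.
-- Reading off the Tutte coefficients gives γ̃(M/I) = Σ_{A ⊇ I} (-1)^|A-I| C(r-r(A)+1, 2), and Möbius inversion
-- yields Σ_{I ⊉ A} γ̃(M/I) = f(A) for the function f of the flag polytope.
module Submission where

open import Defs
open import Data.Bool using (Bool; true; false; if_then_else_; _∨_; _∧_)
open import Data.Empty using (⊥-elim)
open import Data.Fin using (Fin; toℕ) renaming (zero to fzero; suc to fsuc)
open import Data.Fin.Properties using (any?; toℕ<n) renaming (_≟_ to _≟ᶠ_)
open import Data.Fin.Subset using (Subset; _⊆_; _⊂_; _∪_; _∩_; ∁; ∣_∣; ⊤; ⊥; ⁅_⁆; Nonempty; _∈_; _∉_; inside; outside)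
open import Data.Fin.Subset.Properties
open import Data.Integer as ℤ using (ℤ)
import Data.Integer.Properties as ℤ
open import Data.Integer.Tactic.RingSolver using (solve-∀)
open import Data.List using (List; []; _∷_; _++_; map; filter)
open import Data.List.Properties using (filter-++)
open import Data.List.Relation.Unary.All as All using (All; []; _∷_)
open import Data.List.Relation.Unary.All.Properties using (all-filter)
open import Data.Nat as ℕ using (ℕ; zero; suc; _⊓_; _∸_)
import Data.Nat.Properties as ℕ
open import Data.Product using (∃; _×_; _,_; proj₁; proj₂)
open import Data.Rational as ℚ using (ℚ; 0ℚ; 1ℚ; _+_; _*_; _-_; -_; 1/_; _/_; _≤_; nonNegative; toℚᵘ)
import Data.Rational.Properties as ℚ
open import Data.Rational.Solver using (module +-*-Solver)
import Data.Rational.Unnormalised as ℚᵘ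
import Data.Rational.Unnormalised.Properties as ℚᵘ
import Data.Sign as Sign
open import Data.Sum using (_⊎_; inj₁; inj₂; [_,_]′)
open import Data.Vec using ([]; _∷_; lookup; here; there)
open import Data.Vec.Properties using ([]=⇒lookup; lookup⇒[]=)
open import Function using (_∘_; id)
open import Function.Bundles using (_⇔_; mk⇔)
open import Level using (0ℓ)
open import Relation.Binary.PropositionalEquality using (_≡_; _≢_; refl; sym; trans; cong; cong₂; subst; subst₂; module ≡-Reasoning)
open import Relation.Nullary using (¬_; Dec; yes; no; does; ¬?; _×-dec_)
open import Relation.Unary using (Pred; Decidable)
open +-*-Solver using (solve; _:=_; _:+_; _:*_; :-_; con)

-- Edmonds' theorem enters in a form that suits predicates on points: every convex set that contains
-- the greedy points of a submodular function f contains the whole base polytope of f. This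
-- condition, paired with containment in the base polytope, is `Realizes`; it is preserved by
-- dilations and Minkowski sums, so no sum of polytopes ever has to be presented as a convex hull.
--
-- The obstacle is the sign: γ̃(M/I) may be negative, and differences of submodular functions need
-- not be submodular. With the negative terms moved next to the flag polytope, both sides have
-- nonnegative coefficients and the same set function. Its submodularity is read off from the
-- simplices on the positive side and carried over to the other side by the equality.
--
-- Edmonds' theorem is proved without duality. The constraints are finitely many and rational, so
-- the farthest move of a point in a given direction is a computable minimum, and the point is
-- recovered as a convex combination of the two ends of its moves.

private
  variable
    n : ℕ

-- Rational points and their weights on subsets

+-cancelʳ-≤ : ∀ r {p q} → p + r ≤ q + r → p ≤ q
+-cancelʳ-≤ r {p} {q} le = subst₂ _≤_ (lem p r) (lem q r) (ℚ.+-monoˡ-≤ (- r) le)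
  where
  lem : ∀ p r → (p + r) + - r ≡ p
  lem = solve 2 (λ p r → (p :+ r) :+ :- r := p) refl

-- Slack in either inequality would make the sum strict. Uncrossing of tight sets rests on this.
+-squeeze : ∀ {a b c d} → a ≤ c → b ≤ d → c + d ≤ a + b → a ≡ c × b ≡ d
+-squeeze {a} {b} {c} {d} a≤c b≤d le =
    ℚ.≤-antisym a≤c (+-cancelʳ-≤ d (ℚ.≤-trans le (ℚ.+-monoʳ-≤ a b≤d)))
  , ℚ.≤-antisym b≤d (+-cancelʳ-≤ c (subst₂ _≤_ (ℚ.+-comm c d) (ℚ.+-comm c b) (ℚ.≤-trans le (ℚ.+-monoˡ-≤ b a≤c))))

p≤q⇒0≤q-p : ∀ {p q} → p ≤ q → 0ℚ ≤ q - p
p≤q⇒0≤q-p {p} {q} p≤q = subst (_≤ q - p) (ℚ.+-inverseʳ p) (ℚ.+-monoˡ-≤ (- p) p≤q)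

*-nonNeg : ∀ {p q} → 0ℚ ≤ p → 0ℚ ≤ q → 0ℚ ≤ p * q
*-nonNeg {p} {q} 0≤p 0≤q =
  subst (_≤ p * q) (ℚ.*-zeroʳ p) (ℚ.*-monoˡ-≤-nonNeg p {{nonNegative 0≤p}} 0≤q)

+-interchange : ∀ a b c d → (a + b) + (c + d) ≡ (a + c) + (b + d)
+-interchange = solve 4 (λ a b c d → (a :+ b) :+ (c :+ d) := (a :+ c) :+ (b :+ d)) refl

∈⇒indicator : ∀ {S : Subset n} {i} → i ∈ S → indicator S i ≡ 1ℚ
∈⇒indicator i∈S rewrite []=⇒lookup i∈S = refl

∉⇒indicator : ∀ {S : Subset n} {i} → i ∉ S → indicator S i ≡ 0ℚ
∉⇒indicator {S = S} {i} i∉S with lookup S i in eq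
... | inside  = ⊥-elim (i∉S (lookup⇒[]= i S eq))
... | outside = refl

indicator-⊥ : ∀ (i : Fin n) → indicator ⊥ i ≡ 0ℚ
indicator-⊥ i = ∉⇒indicator {S = ⊥} {i} ∉⊥

wt : Pt n → Subset n → ℚ
wt x []      = 0ℚ
wt x (s ∷ A) = (if s then x fzero else 0ℚ) + wt (x ∘ fsuc) A

wt-cong : ∀ {x y : Pt n} A → x ≈ y → wt x A ≡ wt y A
wt-cong []            x≈y = refl
wt-cong (inside  ∷ A) x≈y = cong₂ _+_ (x≈y fzero) (wt-cong A (x≈y ∘ fsuc))
wt-cong (outside ∷ A) x≈y = cong (0ℚ +_) (wt-cong A (x≈y ∘ fsuc))

wt-0v : ∀ (A : Subset n) → wt 0v A ≡ 0ℚ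
wt-0v []            = refl
wt-0v (inside  ∷ A) = trans (ℚ.+-identityˡ _) (wt-0v A)
wt-0v (outside ∷ A) = trans (ℚ.+-identityˡ _) (wt-0v A)

wt-+v : ∀ (x y : Pt n) A → wt (x +v y) A ≡ wt x A + wt y A
wt-+v x y []            = refl
wt-+v x y (inside  ∷ A) = trans (cong ((x fzero + y fzero) +_) (wt-+v (x ∘ fsuc) (y ∘ fsuc) A))
  (+-interchange (x fzero) (y fzero) (wt (x ∘ fsuc) A) (wt (y ∘ fsuc) A))
wt-+v x y (outside ∷ A) = trans (cong (0ℚ +_) (wt-+v (x ∘ fsuc) (y ∘ fsuc) A))
  (+-interchange 0ℚ 0ℚ (wt (x ∘ fsuc) A) (wt (y ∘ fsuc) A))

wt-·v : ∀ c (x : Pt n) A → wt (c ·v x) A ≡ c * wt x A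
wt-·v c x []            = sym (ℚ.*-zeroʳ c)
wt-·v c x (inside  ∷ A) = trans (cong (c * x fzero +_) (wt-·v c (x ∘ fsuc) A))
  (sym (ℚ.*-distribˡ-+ c (x fzero) (wt (x ∘ fsuc) A)))
wt-·v c x (outside ∷ A) = trans (cong₂ _+_ (sym (ℚ.*-zeroʳ c)) (wt-·v c (x ∘ fsuc) A))
  (sym (ℚ.*-distribˡ-+ c 0ℚ (wt (x ∘ fsuc) A)))

wt-⊥ : ∀ (x : Pt n) → wt x ⊥ ≡ 0ℚ
wt-⊥ {zero}  x = refl
wt-⊥ {suc n} x = trans (ℚ.+-identityˡ _) (wt-⊥ (x ∘ fsuc))

wt-modular : ∀ (x : Pt n) A B → wt x (A ∪ B) + wt x (A ∩ B) ≡ wt x A + wt x B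
wt-modular x []      []      = refl
wt-modular x (s ∷ A) (t ∷ B) =
  trans (+-interchange (x? (s ∨ t)) (w (A ∪ B)) (x? (s ∧ t)) (w (A ∩ B)))
    (trans (cong₂ _+_ (head s t) (wt-modular (x ∘ fsuc) A B)) (+-interchange (x? s) (x? t) (w A) (w B)))
  where
  w = wt (x ∘ fsuc)
  x? : Bool → ℚ
  x? s = if s then x fzero else 0ℚ
  head : ∀ s t → x? (s ∨ t) + x? (s ∧ t) ≡ x? s + x? t
  head inside  t       = refl
  head outside t       = ℚ.+-comm (x? t) 0ℚ

wt-singleton : ∀ (i : Fin n) A → wt (indicator ⁅ i ⁆) A ≡ indicator A i
wt-singleton fzero    (inside  ∷ A) = trans (cong (1ℚ +_) (trans (wt-cong A indicator-⊥) (wt-0v A))) (ℚ.+-identityʳ 1ℚ)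
wt-singleton fzero    (outside ∷ A) = trans (ℚ.+-identityˡ _) (trans (wt-cong A indicator-⊥) (wt-0v A))
wt-singleton (fsuc i) (inside  ∷ A) = trans (ℚ.+-identityˡ _) (wt-singleton i A)
wt-singleton (fsuc i) (outside ∷ A) = trans (ℚ.+-identityˡ _) (wt-singleton i A)

-- Base polytopes and their greedy points

record InBase (f : Subset n → ℚ) (x : Pt n) : Set where
  field
    total : wt x ⊤ ≡ f ⊤
    bound : ∀ A → wt x A ≤ f A
open InBase

Submodular : (Subset n → ℚ) → Set
Submodular f = ∀ A B → f (A ∪ B) + f (A ∩ B) ≤ f A + f B

-- An ordering of the elements in which repetitions may occur. Adding an element of S again leaves S
-- as it is, so its increment in `greedy` is 0.
data Chain {n} : Subset n → Set where
  []  : Chain ⊥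
  _▷_ : ∀ {S} → Chain S → (i : Fin n) → Chain (S ∪ ⁅ i ⁆)

-- The point x of the base polytope with x(S) = f(S) for every member S of the chain.
greedy : (Subset n → ℚ) → ∀ {S : Subset n} → Chain S → Pt n
greedy f []              = 0v
greedy f (_▷_ {S} c i) = greedy f c +v ((f (S ∪ ⁅ i ⁆) - f S) ·v indicator ⁅ i ⁆)

greedy-outside : ∀ (f : Subset n → ℚ) {S} (c : Chain S) {j} → j ∉ S → greedy f c j ≡ 0ℚ
greedy-outside f []            j∉ = refl
greedy-outside f (_▷_ {S} c i) j∉ = cong₂ _+_
  (greedy-outside f c (j∉ ∘ p⊆p∪q ⁅ i ⁆))
  (trans (cong ((f (S ∪ ⁅ i ⁆) - f S) *_) (∉⇒indicator (j∉ ∘ q⊆p∪q S ⁅ i ⁆))) (ℚ.*-zeroʳ (f (S ∪ ⁅ i ⁆) - f S)))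

-- Moves inside a base polytope

Respects≈ : (Pt n → Set) → Set
Respects≈ Q = ∀ {p q} → p ≈ q → Q p → Q q

Convex : (Pt n → Set) → Set
Convex Q = ∀ {p q} a b → 0ℚ ≤ a → 0ℚ ≤ b → a + b ≡ 1ℚ → Q p → Q q → Q ((a ·v p) +v (b ·v q))

-- Finds the tightest of the constraints that limit a move in `exchange`.
minimum? : {P : Subset n → Set} → (∀ A → Dec (P A)) → (g : Subset n → ℚ) →
  (∀ A → ¬ P A) ⊎ (∃ λ A → P A × (∀ B → P B → g A ≤ g B))
minimum? {zero} P? g with P? []
... | yes p = inj₂ ([] , p , λ { [] _ → ℚ.≤-refl })
... | no ¬p = inj₁ λ { [] → ¬p }
minimum? {suc n} P? g with minimum? (P? ∘ (inside ∷_)) (g ∘ (inside ∷_)) | minimum? (P? ∘ (outside ∷_)) (g ∘ (outside ∷_))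
... | inj₁ ¬p           | inj₁ ¬q           = inj₁ λ { (inside ∷ A) → ¬p A ; (outside ∷ A) → ¬q A }
... | inj₁ ¬p           | inj₂ (B , q , B≤) = inj₂ (_ , q , λ { (inside ∷ A) p → ⊥-elim (¬p A p) ; (outside ∷ A) → B≤ A })
... | inj₂ (A , p , A≤) | inj₁ ¬q           = inj₂ (_ , p , λ { (inside ∷ B) → A≤ B ; (outside ∷ B) q → ⊥-elim (¬q B q) })
... | inj₂ (A , p , A≤) | inj₂ (B , q , B≤) with ℚ.≤-total (g (inside ∷ A)) (g (outside ∷ B))
...   | inj₁ le = inj₂ (_ , p , λ { (inside ∷ C) r → A≤ C r ; (outside ∷ C) r → ℚ.≤-trans le (B≤ C r) })
...   | inj₂ ge = inj₂ (_ , q , λ { (inside ∷ C) r → ℚ.≤-trans ge (A≤ C r) ; (outside ∷ C) r → B≤ C r })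

-- The direction e_u - e_v has total weight 0, so the move stays in the hyperplane x(E) = f(E). For
-- submodular f these are the edge directions of the base polytope.
shift : Fin n → Fin n → ℚ → Pt n → Pt n
shift u v ε x = x +v (ε ·v (indicator ⁅ u ⁆ +v ((- 1ℚ) ·v indicator ⁅ v ⁆)))

wt-shift : ∀ u v ε (x : Pt n) A → wt (shift u v ε x) A ≡ wt x A + ε * (indicator A u - indicator A v)
wt-shift u v ε x A = begin
  wt (shift u v ε x) A
    ≡⟨ wt-+v x _ A ⟩
  wt x A + wt (ε ·v (indicator ⁅ u ⁆ +v ((- 1ℚ) ·v indicator ⁅ v ⁆))) A
    ≡⟨ cong (wt x A +_) (wt-·v ε _ A) ⟩
  wt x A + ε * wt (indicator ⁅ u ⁆ +v ((- 1ℚ) ·v indicator ⁅ v ⁆)) A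
    ≡⟨ cong (λ z → wt x A + ε * z) (trans (wt-+v (indicator ⁅ u ⁆) _ A) (cong₂ _+_ (wt-singleton u A)
         (trans (wt-·v (- 1ℚ) (indicator ⁅ v ⁆) A) (cong (- 1ℚ *_) (wt-singleton v A))))) ⟩
  wt x A + ε * (indicator A u + - 1ℚ * indicator A v)
    ≡⟨ cong (λ z → wt x A + ε * (indicator A u + z)) (lem (indicator A v)) ⟩
  wt x A + ε * (indicator A u - indicator A v) ∎
  where
  open ≡-Reasoning
  lem : ∀ p → - 1ℚ * p ≡ - p
  lem = solve 1 (λ p → con (- 1ℚ) :* p := :- p) refl

module _ (u v : Fin n) (ε : ℚ) (x : Pt n) {A : Subset n} where

  private
    via : ∀ {a b} → indicator A u ≡ a → indicator A v ≡ b → wt (shift u v ε x) A ≡ wt x A + ε * (a - b)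
    via p q = trans (wt-shift u v ε x A) (cong₂ (λ a b → wt x A + ε * (a - b)) p q)

    zeroed : ∀ w → w + ε * 0ℚ ≡ w
    zeroed w = trans (cong (w +_) (ℚ.*-zeroʳ ε)) (ℚ.+-identityʳ w)

  wt-shift-∈∈ : u ∈ A → v ∈ A → wt (shift u v ε x) A ≡ wt x A
  wt-shift-∈∈ p q = trans (via (∈⇒indicator p) (∈⇒indicator q)) (zeroed _)

  wt-shift-∉∉ : u ∉ A → v ∉ A → wt (shift u v ε x) A ≡ wt x A
  wt-shift-∉∉ p q = trans (via (∉⇒indicator p) (∉⇒indicator q)) (zeroed _)

  wt-shift-∈∉ : u ∈ A → v ∉ A → wt (shift u v ε x) A ≡ wt x A + ε
  wt-shift-∈∉ p q = trans (via (∈⇒indicator p) (∉⇒indicator q)) (cong (wt x A +_) (ℚ.*-identityʳ ε))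

  wt-shift-∉∈ : u ∉ A → v ∈ A → wt (shift u v ε x) A ≡ wt x A - ε
  wt-shift-∉∈ p q = trans (via (∉⇒indicator p) (∈⇒indicator q)) (cong (wt x A +_) (lem ε))
    where
    lem : ∀ ε → ε * (0ℚ - 1ℚ) ≡ - ε
    lem = solve 1 (λ ε → ε :* con (0ℚ - 1ℚ) := :- ε) refl

shift-fixes : ∀ {u v : Fin n} ε x {j} → j ≢ u → j ≢ v → shift u v ε x j ≡ x j
shift-fixes {u = u} {v} ε x {j} j≢u j≢v
  rewrite ∉⇒indicator (x≢y⇒x∉⁅y⁆ j≢u) | ∉⇒indicator (x≢y⇒x∉⁅y⁆ j≢v)
  = trans (cong (x j +_) (ℚ.*-zeroʳ ε)) (ℚ.+-identityʳ (x j))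

-- The point x lies between its two displacements, with weights δ/(ε+δ) and ε/(ε+δ). The case ε = 0,
-- where the first displacement is x itself, is split off so that ε+δ can be inverted.
convex-shift : ∀ {Q : Pt n → Set} → Respects≈ Q → Convex Q → ∀ {u v x ε δ} → 0ℚ ≤ ε → 0ℚ ≤ δ →
  Q (shift u v ε x) → Q (shift v u δ x) → Q x
convex-shift {Q = Q} resp convex {u} {v} {x} {ε} {δ} 0≤ε 0≤δ q q′ with ε ℚ.≟ 0ℚ
... | yes refl = resp (λ i → trans (cong (x i +_) (ℚ.*-zeroˡ (indicator ⁅ u ⁆ i + - 1ℚ * indicator ⁅ v ⁆ i))) (ℚ.+-identityʳ (x i))) q
... | no ε≢0 = resp eq (convex (δ * t) (ε * t) (*-nonNeg 0≤δ 0≤t) (*-nonNeg 0≤ε 0≤t) sum≡1 q q′)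
  where
  0<s : 0ℚ ℚ.< ε + δ
  0<s = ℚ.≰⇒> λ le → ε≢0 (sym (proj₁ (+-squeeze 0≤ε 0≤δ le)))
  instance
    s-pos : ℚ.Positive (ε + δ)
    s-pos = ℚ.positive 0<s
    s-nonZero : ℚ.NonZero (ε + δ)
    s-nonZero = ℚ.pos⇒nonZero (ε + δ)
  t : ℚ
  t = 1/ (ε + δ)
  0≤t : 0ℚ ≤ t
  0≤t = ℚ.<⇒≤ (ℚ.positive⁻¹ t {{ℚ.1/pos⇒pos (ε + δ)}})
  sum≡1 : δ * t + ε * t ≡ 1ℚ
  sum≡1 = trans (solve 3 (λ δ ε t → δ :* t :+ ε :* t := (ε :+ δ) :* t) refl δ ε t) (ℚ.*-inverseʳ (ε + δ))
  eq : (((δ * t) ·v shift u v ε x) +v ((ε * t) ·v shift v u δ x)) ≈ x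
  eq i = trans
    (solve 6 (λ δ ε t x u v →
        (δ :* t) :* (x :+ ε :* (u :+ con (- 1ℚ) :* v)) :+ (ε :* t) :* (x :+ δ :* (v :+ con (- 1ℚ) :* u))
        := (δ :* t :+ ε :* t) :* x) refl
      δ ε t (x i) (indicator ⁅ u ⁆ i) (indicator ⁅ v ⁆ i))
    (trans (cong (_* x i) sum≡1) (ℚ.*-identityˡ (x i)))

-- Moving along e_u - e_v raises x(A) only if A contains u and misses v. The least slack f(A) - x(A)
-- among these sets is the farthest admissible move, and a set attaining it becomes tight.
exchange : ∀ {f : Subset n → ℚ} {x u v} → InBase f x → u ≢ v →
  ∃ λ ε → 0ℚ ≤ ε × InBase f (shift u v ε x) × ∃ λ A → u ∈ A × v ∉ A × wt (shift u v ε x) A ≡ f A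
exchange {f = f} {x} {u} {v} base u≢v
  with minimum? (λ A → (u ∈? A) ×-dec ¬? (v ∈? A)) (λ A → f A - wt x A)
-- The set {u} is a candidate because u ≠ v, so a minimum exists.
... | inj₁ none = ⊥-elim (none ⁅ u ⁆ (x∈⁅x⁆ u , x≢y⇒x∉⁅y⁆ (u≢v ∘ sym)))
... | inj₂ (A , (u∈A , v∉A) , least) = ε , 0≤ε , base′ , A , u∈A , v∉A , trans (wt-shift-∈∉ u v ε x u∈A v∉A) (cancel (wt x A) (f A))
  where
  ε = f A - wt x A
  0≤ε : 0ℚ ≤ ε
  0≤ε = p≤q⇒0≤q-p (bound base A)
  cancel : ∀ p q → p + (q - p) ≡ q
  cancel = solve 2 (λ p q → p :+ (q :+ :- p) := q) refl
  base′ : InBase f (shift u v ε x)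
  total base′ = trans (wt-shift-∈∈ u v ε x ∈⊤ ∈⊤) (total base)
  bound base′ B with u ∈? B | v ∈? B
  ... | yes u∈ | yes v∈ = subst (_≤ f B) (sym (wt-shift-∈∈ u v ε x u∈ v∈)) (bound base B)
  ... | no u∉  | no v∉  = subst (_≤ f B) (sym (wt-shift-∉∉ u v ε x u∉ v∉)) (bound base B)
  ... | yes u∈ | no v∉  = subst₂ _≤_ (sym (wt-shift-∈∉ u v ε x u∈ v∉)) (cancel (wt x B) (f B))
                            (ℚ.+-monoʳ-≤ (wt x B) (least B (u∈ , v∉)))
  ... | no u∉  | yes v∈ = subst (_≤ f B) (sym (wt-shift-∉∈ u v ε x u∉ v∈))
                            (ℚ.≤-trans (subst (wt x B - ε ≤_) (ℚ.+-identityʳ (wt x B)) (ℚ.+-monoʳ-≤ (wt x B) (ℚ.neg-antimono-≤ 0≤ε))) (bound base B))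

-- Edmonds' theorem

module Edmonds (f : Subset n → ℚ) (submodular : Submodular f) (f⊥≡0 : f ⊥ ≡ 0ℚ)
  (Q : Pt n → Set) (resp : Respects≈ Q) (convex : Convex Q) (greedy∈Q : ∀ (c : Chain (⊤ {n})) → Q (greedy f c)) where

  private
    Tight : Pt n → Subset n → Set
    Tight x A = wt x A ≡ f A

    -- The weight of x is modular and f is submodular, so x(A ∪ B) + x(A ∩ B) = f(A) + f(B) ≥ f(A ∪
    -- B) + f(A ∩ B), while each term on the left is at most its counterpart on the right.
    tight-lattice : ∀ {x A B} → InBase f x → Tight x A → Tight x B → Tight x (A ∪ B) × Tight x (A ∩ B)
    tight-lattice {x} {A} {B} base tA tB = +-squeeze (bound base _) (bound base _)
      (subst (f (A ∪ B) + f (A ∩ B) ≤_) (sym (trans (wt-modular x A B) (cong₂ _+_ tA tB))) (submodular A B))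

    -- Invariant of the search. `agree` turns x into a greedy point once S = `⊤`; `tight` is what
    -- forces the next coordinate of x to be the increment of f.
    record State {S} (c : Chain S) (x : Pt n) : Set where
      field
        base  : InBase f x
        agree : ∀ {j} → j ∈ S → x j ≡ greedy f c j
        tight : Tight x S
    open State

    -- Since S and S ∪ {i} are both tight, x_i = x(S ∪ {i}) - x(S) = f(S ∪ {i}) - f(S), which is the
    -- coordinate that `greedy` gives to i.
    extend : ∀ {S} {c : Chain S} {x i} → State c x → i ∉ S → Tight x (S ∪ ⁅ i ⁆) → State (c ▷ i) x
    base (extend st i∉S tT) = base st
    tight (extend st i∉S tT) = tT
    agree (extend {S} {c} {x} {i} st i∉S tT) {j} j∈ with j ≟ᶠ i
    ... | yes refl = sym (begin
        greedy f c j + (f (S ∪ ⁅ j ⁆) - f S) * indicator ⁅ j ⁆ j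
          ≡⟨ cong₂ (λ a b → a + (f (S ∪ ⁅ j ⁆) - f S) * b) (greedy-outside f c i∉S) (∈⇒indicator (x∈⁅x⁆ j)) ⟩
        0ℚ + (f (S ∪ ⁅ j ⁆) - f S) * 1ℚ
          ≡⟨ cong₂ (λ a b → 0ℚ + (a - b) * 1ℚ) (sym tT) (sym (tight st)) ⟩
        0ℚ + (wt x (S ∪ ⁅ j ⁆) - wt x S) * 1ℚ
          -- The 0 that is inserted stands for x(S ∩ {j}), so that modularity applies.
          ≡⟨ solve 2 (λ a b → con 0ℚ :+ (a :+ :- b) :* con 1ℚ := (a :+ con 0ℚ) :+ :- b) refl (wt x (S ∪ ⁅ j ⁆)) (wt x S) ⟩
        (wt x (S ∪ ⁅ j ⁆) + 0ℚ) - wt x S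
          ≡⟨ cong (λ a → (wt x (S ∪ ⁅ j ⁆) + a) - wt x S) (sym (trans (cong (wt x) S∩j≡⊥) (wt-⊥ x))) ⟩
        (wt x (S ∪ ⁅ j ⁆) + wt x (S ∩ ⁅ j ⁆)) - wt x S
          ≡⟨ cong (_- wt x S) (wt-modular x S ⁅ j ⁆) ⟩
        (wt x S + wt x ⁅ j ⁆) - wt x S
          ≡⟨ solve 2 (λ a b → (a :+ b) :+ :- a := b) refl (wt x S) (wt x ⁅ j ⁆) ⟩
        wt x ⁅ j ⁆
          ≡⟨ wt-⁅⁆ x j ⟩
        x j ∎)
      where
      open ≡-Reasoning
      S∩j≡⊥ : S ∩ ⁅ j ⁆ ≡ ⊥
      S∩j≡⊥ = Empty-unique λ (k , k∈) → i∉S (subst (_∈ S) (x∈⁅y⁆⇒x≡y j (p∩q⊆q S ⁅ j ⁆ k∈)) (p∩q⊆p S ⁅ j ⁆ k∈))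
      wt-⁅⁆ : ∀ {m} (x : Pt m) j → wt x ⁅ j ⁆ ≡ x j
      wt-⁅⁆ x fzero    = trans (cong (x fzero +_) (wt-⊥ (x ∘ fsuc))) (ℚ.+-identityʳ (x fzero))
      wt-⁅⁆ x (fsuc j) = trans (ℚ.+-identityˡ _) (wt-⁅⁆ (x ∘ fsuc) j)
    ... | no j≢i with x∈p∪q⁻ S ⁅ i ⁆ j∈
    ...   | inj₂ j∈⁅i⁆ = ⊥-elim (j≢i (x∈⁅y⁆⇒x≡y i j∈⁅i⁆))
    ...   | inj₁ j∈S = trans (agree st j∈S) (sym (trans
            (cong (λ a → greedy f c j + (f (S ∪ ⁅ i ⁆) - f S) * a) (∉⇒indicator (x≢y⇒x∉⁅y⁆ j≢i)))
            (trans (cong (greedy f c j +_) (ℚ.*-zeroʳ (f (S ∪ ⁅ i ⁆) - f S))) (ℚ.+-identityʳ _))))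

    -- Refine the flag of tight sets S ⊂ T by moving x both ways along e_u - e_v (u, v ∈ T ∖ S) until
    -- a new set becomes tight; once |T ∖ S| = 1, T joins the chain.
    next   : ∀ a {S} (c : Chain S) {x} → State c x → n ℕ.≤ a ℕ.+ ∣ S ∣ → Q x
    refine : ∀ a b {S} (c : Chain S) {x} → State c x → n ℕ.≤ suc a ℕ.+ ∣ S ∣ →
      ∀ {T i} → Tight x T → S ⊆ T → i ∈ T → i ∉ S → ∣ T ∣ ℕ.≤ b → Q x

    next a {S} c {x} st n≤ with any? (λ i → ¬? (i ∈? S))
    ... | no ¬∉ = finish S≡⊤ c st
      where
      S≡⊤ : S ≡ ⊤
      S≡⊤ = ⊆-antisym (⊆⊤) (λ {i} _ → [ id , (λ i∉ → ⊥-elim (¬∉ (i , i∉))) ]′ (dec i))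
        where
        dec : ∀ i → i ∈ S ⊎ i ∉ S
        dec i with i ∈? S
        ... | yes p = inj₁ p
        ... | no p  = inj₂ p
      finish : ∀ {S} → S ≡ ⊤ → (c : Chain S) → State c x → Q x
      finish refl c st = resp (λ i → sym (agree st ∈⊤)) (greedy∈Q c)
    -- Here `a` bounds the number of elements outside S and drives the termination; for a fixed
    -- value of it, `b` bounds the size of T.
    next zero {S} c st n≤ | yes (i , i∉S) =
      ⊥-elim (i∉S (subst (i ∈_) (sym (∣p∣≡n⇒p≡⊤ (ℕ.≤-antisym (∣p∣≤n S) n≤))) ∈⊤))
    -- The upper tight set starts as `⊤`, which is tight because x(E) = f(E).
    next (suc a) c st n≤ | yes (i , i∉S) =
      refine a n c st n≤ (total (base st)) ⊆⊤ ∈⊤ i∉S (∣p∣≤n ⊤)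

    refine a b {S} c {x} st n≤ {T} {i} tT S⊆T i∈T i∉S ∣T∣≤b
      with any? (λ j → (j ∈? T) ×-dec (¬? (j ∈? S) ×-dec ¬? (j ≟ᶠ i)))
    ... | no none = next a (c ▷ i) (extend st i∉S (subst (Tight x) T≡ tT)) size
      where
      T⊆ : T ⊆ S ∪ ⁅ i ⁆
      T⊆ {j} j∈T with j ∈? S | j ≟ᶠ i
      ... | yes j∈S | _        = p⊆p∪q ⁅ i ⁆ j∈S
      ... | no _    | yes refl = q⊆p∪q S ⁅ j ⁆ (x∈⁅x⁆ j)
      ... | no j∉S  | no j≢i   = ⊥-elim (none (j , j∈T , j∉S , j≢i))
      T≡ : T ≡ S ∪ ⁅ i ⁆
      T≡ = ⊆-antisym T⊆ λ {j} j∈ → [ S⊆T , (λ j∈i → subst (_∈ T) (sym (x∈⁅y⁆⇒x≡y i j∈i)) i∈T) ]′ (x∈p∪q⁻ S ⁅ i ⁆ j∈)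
      size : n ℕ.≤ a ℕ.+ ∣ S ∪ ⁅ i ⁆ ∣
      size = ℕ.≤-trans n≤ (ℕ.≤-trans (ℕ.≤-reflexive (sym (ℕ.+-suc a ∣ S ∣)))
        (ℕ.+-monoʳ-≤ a (p⊂q⇒∣p∣<∣q∣ (p⊆p∪q ⁅ i ⁆ , i , q⊆p∪q S ⁅ i ⁆ (x∈⁅x⁆ i) , i∉S))))
    refine a zero {S} c {x} st n≤ {T} {i} tT S⊆T i∈T i∉S ∣T∣≤0 | yes _ =
      ⊥-elim (ℕ.n≮0 (ℕ.<-≤-trans (p⊂q⇒∣p∣<∣q∣ (⊥⊆ , i , i∈T , ∉⊥)) ∣T∣≤0))
    refine a (suc b) {S} c {x} st n≤ {T} {i} tT S⊆T i∈T i∉S ∣T∣≤b | yes (j , j∈T , j∉S , j≢i) =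
      convex-shift resp convex {i} {j} (proj₁ (proj₂ towards-i)) (proj₁ (proj₂ towards-j)) (proj₂ (proj₂ towards-i)) (proj₂ (proj₂ towards-j))
      where
      move : ∀ {u v} → u ≢ v → u ∈ T → u ∉ S → v ∈ T → v ∉ S → ∃ λ ε → 0ℚ ≤ ε × Q (shift u v ε x)
      move {u} {v} u≢v u∈T u∉S v∈T v∉S with exchange (base st) u≢v
      ... | ε , 0≤ε , base′ , A , u∈A , v∉A , tA = ε , 0≤ε ,
        -- The new tight set A need not lie between S and T. Joining it with S and meeting the
        -- result with T repairs this, keeps u and still omits v, so the set is strictly smaller
        -- than T. Both S and T stay tight, since u and v lie in T and outside S.
        refine a b c st′ n≤ {(A ∪ S) ∩ T} {u}
          (proj₂ (tight-lattice base′ (proj₁ (tight-lattice base′ tA (tight st′))) (trans (wt-shift-∈∈ u v ε x u∈T v∈T) tT)))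
          (λ k∈S → x∈p∩q⁺ (q⊆p∪q A S k∈S , S⊆T k∈S))
          (x∈p∩q⁺ (p⊆p∪q S u∈A , u∈T)) u∉S
          (ℕ.≤-pred (ℕ.<-≤-trans (p⊂q⇒∣p∣<∣q∣ (p∩q⊆q (A ∪ S) T , v , v∈T , v∉)) ∣T∣≤b))
        where
        st′ : State c (shift u v ε x)
        base st′ = base′
        agree st′ k∈S = trans (shift-fixes {u = u} {v} ε x (λ { refl → u∉S k∈S }) (λ { refl → v∉S k∈S })) (agree st k∈S)
        tight st′ = trans (wt-shift-∉∉ u v ε x u∉S v∉S) (tight st)
        v∉ : v ∉ (A ∪ S) ∩ T
        v∉ v∈ = [ v∉A , v∉S ]′ (x∈p∪q⁻ A S (p∩q⊆p (A ∪ S) T v∈))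
      towards-i = move {i} {j} (j≢i ∘ sym) i∈T i∉S j∈T j∉S
      towards-j = move {j} {i} j≢i j∈T j∉S i∈T i∉S

  base⊆Q : ∀ {x} → InBase f x → Q x
  base⊆Q {x} b = next n [] st (ℕ.m≤m+n n _)
    where
    st : State [] x
    base st = b
    agree st j∈⊥ = ⊥-elim (∉⊥ j∈⊥)
    tight st = trans (wt-⊥ x) (sym f⊥≡0)

-- Polytopes realizing a set function

record Realizes (Q : Pt n → Set) (f : Subset n → ℚ) : Set where
  field
    respects : Respects≈ Q
    convex   : Convex Q
    inBase   : ∀ {p} → Q p → InBase f p
    greedy∈  : ∀ (c : Chain (⊤ {n})) → Q (greedy f c)
open Realizes

inBase-resp : ∀ {f g : Subset n → ℚ} {x y} → (∀ A → f A ≡ g A) → x ≈ y → InBase f x → InBase g y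
total (inBase-resp f≗g x≈y b) = trans (sym (wt-cong ⊤ x≈y)) (trans (total b) (f≗g ⊤))
bound (inBase-resp f≗g x≈y b) A = subst₂ _≤_ (wt-cong A x≈y) (f≗g A) (bound b A)

-- Points of P lie in the base polytope of f, which is that of g, and Edmonds' theorem places that
-- base polytope inside Q; the converse is symmetric. Submodularity of g crosses to f by `f≗g`.
realizes⇒⇔ : ∀ {P Q : Pt n → Set} {f g} → Realizes P f → Realizes Q g → (∀ A → f A ≡ g A) →
  Submodular g → g ⊥ ≡ 0ℚ → ∀ p → P p ⇔ Q p
realizes⇒⇔ {P = P} {Q} {f} {g} rP rQ f≗g submodular g⊥≡0 p = mk⇔
  (λ Pp → Edmonds.base⊆Q g submodular g⊥≡0 Q (respects rQ) (convex rQ) (greedy∈ rQ)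
            (inBase-resp f≗g (λ _ → refl) (inBase rP Pp)))
  (λ Qp → Edmonds.base⊆Q f submodular′ (trans (f≗g ⊥) g⊥≡0) P (respects rP) (convex rP) (greedy∈ rP)
            (inBase-resp (sym ∘ f≗g) (λ _ → refl) (inBase rQ Qp)))
  where
  submodular′ : Submodular f
  submodular′ A B = subst₂ _≤_ (sym (cong₂ _+_ (f≗g (A ∪ B)) (f≗g (A ∩ B)))) (sym (cong₂ _+_ (f≗g A) (f≗g B))) (submodular A B)

greedy-0 : ∀ {S : Subset n} (c : Chain S) → greedy (λ _ → 0ℚ) c ≈ 0v
greedy-0 []      j = refl
greedy-0 (c ▷ i) j = cong₂ _+_ (greedy-0 c j) (ℚ.*-zeroˡ (indicator ⁅ i ⁆ j))

greedy-+ : ∀ (f g : Subset n → ℚ) {S} (c : Chain S) → greedy (λ A → f A + g A) c ≈ (greedy f c +v greedy g c)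
greedy-+ f g []            j = refl
greedy-+ f g (_▷_ {S} c i) j = trans (cong (_+ (((f S′ + g S′) - (f S + g S)) * e)) (greedy-+ f g c j))
  (solve 7 (λ x y a b a′ b′ e → (x :+ y) :+ (((a′ :+ b′) :+ :- (a :+ b)) :* e)
      := (x :+ (a′ :+ :- a) :* e) :+ (y :+ (b′ :+ :- b) :* e)) refl
    (greedy f c j) (greedy g c j) (f S) (g S) (f S′) (g S′) e)
  where
  S′ = S ∪ ⁅ i ⁆
  e = indicator ⁅ i ⁆ j

greedy-* : ∀ y (f : Subset n → ℚ) {S} (c : Chain S) → greedy (λ A → y * f A) c ≈ (y ·v greedy f c)
greedy-* y f []            j = sym (ℚ.*-zeroʳ y)
greedy-* y f (_▷_ {S} c i) j = trans (cong (_+ ((y * f S′ - y * f S) * e)) (greedy-* y f c j))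
  (solve 5 (λ y x a a′ e → y :* x :+ (y :* a′ :+ :- (y :* a)) :* e := y :* (x :+ (a′ :+ :- a) :* e)) refl
    y (greedy f c j) (f S) (f S′) e)
  where
  S′ = S ∪ ⁅ i ⁆
  e = indicator ⁅ i ⁆ j

-- Convex hulls, dilations and Minkowski sums

all-++ : ∀ {A : Set} {P : A → Set} {xs ys} → AllL P xs → AllL P ys → AllL P (xs ++ ys)
all-++ []       qs = qs
all-++ (p ∷ ps) qs = p ∷ all-++ ps qs

all-map : ∀ {A B : Set} {P : A → Set} {R : B → Set} {g : A → B} →
  (∀ x → P x → R (g x)) → ∀ {xs} → AllL P xs → AllL R (map g xs)
all-map h []       = []
all-map h (p ∷ ps) = h _ p ∷ all-map h ps

rescale : ℚ → List (ℚ × Pt n) → List (ℚ × Pt n)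
rescale a = map λ (c , v) → (a * c , v)

sumW-rescale : ∀ a (ws : List (ℚ × Pt n)) → sumW (rescale a ws) ≈ (a ·v sumW ws)
sumW-rescale a []             j = sym (ℚ.*-zeroʳ a)
sumW-rescale a ((c , v) ∷ ws) j = trans (cong (a * c * v j +_) (sumW-rescale a ws j))
  (solve 4 (λ a c v s → a :* c :* v :+ a :* s := a :* (c :* v :+ s)) refl a c (v j) (sumW ws j))

sumC-rescale : ∀ a (ws : List (ℚ × Pt n)) → sumC (rescale a ws) ≡ a * sumC ws
sumC-rescale a []             = sym (ℚ.*-zeroʳ a)
sumC-rescale a ((c , v) ∷ ws) = trans (cong (a * c +_) (sumC-rescale a ws)) (sym (ℚ.*-distribˡ-+ a c (sumC ws)))

sumW-++ : ∀ (us ws : List (ℚ × Pt n)) → sumW (us ++ ws) ≈ (sumW us +v sumW ws)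
sumW-++ []             ws j = sym (ℚ.+-identityˡ (sumW ws j))
sumW-++ ((c , v) ∷ us) ws j = trans (cong (c * v j +_) (sumW-++ us ws j)) (sym (ℚ.+-assoc (c * v j) (sumW us j) (sumW ws j)))

sumC-++ : ∀ (us ws : List (ℚ × Pt n)) → sumC (us ++ ws) ≡ sumC us + sumC ws
sumC-++ []             ws = sym (ℚ.+-identityˡ (sumC ws))
sumC-++ ((c , v) ∷ us) ws = trans (cong (c +_) (sumC-++ us ws)) (sym (ℚ.+-assoc c (sumC us) (sumC ws)))

conv-convex : ∀ (V : Pt n → Set) → Convex (conv V)
conv-convex V {p} {q} a b 0≤a 0≤b a+b≡1 (us , us∈ , us≡1 , p≈) (ws , ws∈ , ws≡1 , q≈) =
    rescale a us ++ rescale b ws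
  , all-++ (all-map (λ (c , v) (0≤c , Vv) → *-nonNeg 0≤a 0≤c , Vv) us∈)
           (all-map (λ (c , v) (0≤c , Vv) → *-nonNeg 0≤b 0≤c , Vv) ws∈)
  , (begin
      sumC (rescale a us ++ rescale b ws)        ≡⟨ sumC-++ (rescale a us) (rescale b ws) ⟩
      sumC (rescale a us) + sumC (rescale b ws)  ≡⟨ cong₂ _+_ (sumC-rescale a us) (sumC-rescale b ws) ⟩
      a * sumC us + b * sumC ws                  ≡⟨ cong₂ (λ s t → a * s + b * t) us≡1 ws≡1 ⟩
      a * 1ℚ + b * 1ℚ                            ≡⟨ cong₂ _+_ (ℚ.*-identityʳ a) (ℚ.*-identityʳ b) ⟩
      a + b                                      ≡⟨ a+b≡1 ⟩
      1ℚ                                         ∎)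
  , λ j → trans (cong₂ (λ s t → a * s + b * t) (p≈ j) (q≈ j))
      (sym (trans (sumW-++ (rescale a us) (rescale b ws) j) (cong₂ _+_ (sumW-rescale a us j) (sumW-rescale b ws j))))
  where open ≡-Reasoning

-- The predicate on weighted points inside `conv` is an anonymous pattern-matching function. Keeping
-- P abstract lets unification supply that very function.
module _ {f : Subset n → ℚ} {P : ℚ × Pt n → Set} (P⇒ : ∀ c v → P (c , v) → 0ℚ ≤ c × InBase f v) where

  sumW-bound : ∀ {ws} → AllL P ws → ∀ A → wt (sumW ws) A ≤ sumC ws * f A
  sumW-bound []                          A = ℚ.≤-reflexive (trans (wt-0v A) (sym (ℚ.*-zeroˡ (f A))))
  sumW-bound (_∷_ {c , v} {ws} Pcv all) A = subst₂ _≤_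
    (sym (trans (wt-+v (c ·v v) (sumW ws) A) (cong (_+ wt (sumW ws) A) (wt-·v c v A))))
    (sym (ℚ.*-distribʳ-+ (f A) c (sumC ws)))
    (ℚ.+-mono-≤ (ℚ.*-monoˡ-≤-nonNeg c {{nonNegative (proj₁ (P⇒ c v Pcv))}} (bound (proj₂ (P⇒ c v Pcv)) A)) (sumW-bound all A))

  sumW-total : ∀ {ws} → AllL P ws → wt (sumW ws) ⊤ ≡ sumC ws * f ⊤
  sumW-total []                         = trans (wt-0v (⊤ {n})) (sym (ℚ.*-zeroˡ (f ⊤)))
  sumW-total (_∷_ {c , v} {ws} Pcv all) = trans
    (trans (wt-+v (c ·v v) (sumW ws) ⊤) (cong (_+ wt (sumW ws) ⊤) (wt-·v c v ⊤)))
    (trans (cong₂ (λ s t → c * s + t) (total (proj₂ (P⇒ c v Pcv))) (sumW-total all)) (sym (ℚ.*-distribʳ-+ (f ⊤) c (sumC ws))))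

conv-realizes : ∀ {V : Pt n → Set} {f} → (∀ {v} → V v → InBase f v) → (∀ (c : Chain (⊤ {n})) → V (greedy f c)) →
  Realizes (conv V) f
respects (conv-realizes V⊆ greedy∈V) p≈q (ws , ws∈ , ws≡1 , p≈) = ws , ws∈ , ws≡1 , λ j → trans (sym (p≈q j)) (p≈ j)
convex (conv-realizes {V = V} V⊆ greedy∈V) = conv-convex V
inBase (conv-realizes {f = f} V⊆ greedy∈V) (ws , ws∈ , ws≡1 , p≈) = inBase-resp (λ _ → refl) (λ j → sym (p≈ j)) base
  where
  one* : ∀ A → sumC ws * f A ≡ f A
  one* A = trans (cong (_* f A) ws≡1) (ℚ.*-identityˡ (f A))
  base : InBase f (sumW ws)
  total base   = trans (sumW-total (λ c v (0≤c , Vv) → 0≤c , V⊆ Vv) ws∈) (one* ⊤)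
  bound base A = subst (wt (sumW ws) A ≤_) (one* A) (sumW-bound (λ c v (0≤c , Vv) → 0≤c , V⊆ Vv) ws∈ A)
greedy∈ (conv-realizes {f = f} V⊆ greedy∈V) c =
    (1ℚ , greedy f c) ∷ []
  , (ℚ.nonNegative⁻¹ 1ℚ , greedy∈V c) ∷ []
  , refl
  , λ j → sym (trans (ℚ.+-identityʳ (1ℚ * greedy f c j)) (ℚ.*-identityˡ (greedy f c j)))

scale-realizes : ∀ {Q : Pt n → Set} {f y} → 0ℚ ≤ y → Realizes Q f → Realizes (scale y Q) (λ A → y * f A)
respects (scale-realizes 0≤y r) p≈q (q , Qq , p≈) = q , Qq , λ j → trans (sym (p≈q j)) (p≈ j)
convex (scale-realizes {y = y} 0≤y r) a b 0≤a 0≤b a+b≡1 (p , Qp , p≈) (q , Qq , q≈) =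
    (a ·v p) +v (b ·v q)
  , convex r a b 0≤a 0≤b a+b≡1 Qp Qq
  , λ j → trans (cong₂ (λ s t → a * s + b * t) (p≈ j) (q≈ j))
      (solve 5 (λ a b y p q → a :* (y :* p) :+ b :* (y :* q) := y :* (a :* p :+ b :* q)) refl a b y (p j) (q j))
inBase (scale-realizes {f = f} {y} 0≤y r) (q , Qq , p≈) = inBase-resp (λ _ → refl) (λ j → sym (p≈ j)) base
  where
  base : InBase (λ A → y * f A) (y ·v q)
  total base   = trans (wt-·v y q ⊤) (cong (y *_) (total (inBase r Qq)))
  bound base A = subst (_≤ y * f A) (sym (wt-·v y q A)) (ℚ.*-monoˡ-≤-nonNeg y {{nonNegative 0≤y}} (bound (inBase r Qq) A))
greedy∈ (scale-realizes {f = f} {y} 0≤y r) c = greedy f c , greedy∈ r c , greedy-* y f c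

minkSum-[]-realizes : Realizes {n} (minkSum []) (λ _ → 0ℚ)
respects minkSum-[]-realizes p≈q p≈0 j = trans (sym (p≈q j)) (p≈0 j)
convex minkSum-[]-realizes a b _ _ _ p≈0 q≈0 j =
  trans (cong₂ (λ s t → a * s + b * t) (p≈0 j) (q≈0 j)) (cong₂ _+_ (ℚ.*-zeroʳ a) (ℚ.*-zeroʳ b))
total (inBase (minkSum-[]-realizes {n}) p≈0)   = trans (wt-cong ⊤ p≈0) (wt-0v (⊤ {n}))
bound (inBase minkSum-[]-realizes p≈0) A = ℚ.≤-reflexive (trans (wt-cong A p≈0) (wt-0v A))
greedy∈ minkSum-[]-realizes c = greedy-0 c

minkSum-∷-realizes : ∀ {Q : Pt n → Set} {Qs f g} → Realizes Q f → Realizes (minkSum Qs) g →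
  Realizes (minkSum (Q ∷ Qs)) (λ A → f A + g A)
respects (minkSum-∷-realizes r rs) p≈q (u , v , Qu , Qv , p≈) = u , v , Qu , Qv , λ j → trans (sym (p≈q j)) (p≈ j)
convex (minkSum-∷-realizes r rs) a b 0≤a 0≤b a+b≡1 (u , v , Qu , Qv , p≈) (u′ , v′ , Qu′ , Qv′ , q≈) =
    (a ·v u) +v (b ·v u′) , (a ·v v) +v (b ·v v′)
  , convex r a b 0≤a 0≤b a+b≡1 Qu Qu′ , convex rs a b 0≤a 0≤b a+b≡1 Qv Qv′
  , λ j → trans (cong₂ (λ s t → a * s + b * t) (p≈ j) (q≈ j))
      (solve 6 (λ a b u v u′ v′ → a :* (u :+ v) :+ b :* (u′ :+ v′) := (a :* u :+ b :* u′) :+ (a :* v :+ b :* v′)) refl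
        a b (u j) (v j) (u′ j) (v′ j))
inBase (minkSum-∷-realizes {f = f} {g} r rs) (u , v , Qu , Qv , p≈) = inBase-resp (λ _ → refl) (λ j → sym (p≈ j)) base
  where
  base : InBase (λ A → f A + g A) (u +v v)
  total base   = trans (wt-+v u v ⊤) (cong₂ _+_ (total (inBase r Qu)) (total (inBase rs Qv)))
  bound base A = subst (_≤ f A + g A) (sym (wt-+v u v A)) (ℚ.+-mono-≤ (bound (inBase r Qu) A) (bound (inBase rs Qv) A))
greedy∈ (minkSum-∷-realizes {f = f} {g} r rs) c = greedy f c , greedy g c , greedy∈ r c , greedy∈ rs c , greedy-+ f g c

sumℚ : ∀ {A : Set} → (A → ℚ) → List A → ℚ
sumℚ g []       = 0ℚ
sumℚ g (x ∷ xs) = g x + sumℚ g xs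

minkSum-map-realizes : ∀ {X : Set} (Q : X → Pt n → Set) (f : X → Subset n → ℚ) {xs} →
  All (λ x → Realizes (Q x) (f x)) xs → Realizes (minkSum (map Q xs)) (λ A → sumℚ (λ x → f x A) xs)
minkSum-map-realizes Q f []       = minkSum-[]-realizes
minkSum-map-realizes Q f (r ∷ rs) = minkSum-∷-realizes r (minkSum-map-realizes Q f rs)

-- Simplices

meets : Subset n → Subset n → Bool
meets []      []      = false
meets (s ∷ A) (t ∷ B) = (s ∧ t) ∨ meets A B

-- The support function of the simplex on J at the indicator of A: the maximum of the weight of A at
-- the vertices e_j with j in J, for nonempty J.
cover : Subset n → Subset n → ℚ
cover J A = if meets A J then 1ℚ else 0ℚ

∈⇒meets : ∀ {A B : Subset n} {i} → i ∈ A → i ∈ B → meets A B ≡ true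
∈⇒meets                             here      here      = refl
∈⇒meets {A = outside ∷ _}             (there p) (there q) = ∈⇒meets p q
∈⇒meets {A = inside ∷ _} {outside ∷ _} (there p) (there q) = ∈⇒meets p q
∈⇒meets {A = inside ∷ _} {inside ∷ _}  (there p) (there q) = refl

meets⇒∈ : ∀ (A B : Subset n) → meets A B ≡ true → ∃ λ i → i ∈ A × i ∈ B
meets⇒∈ []            []            ()
meets⇒∈ (inside  ∷ A) (inside  ∷ B) _  = fzero , here , here
meets⇒∈ (inside  ∷ A) (outside ∷ B) eq = let i , p , q = meets⇒∈ A B eq in fsuc i , there p , there q
meets⇒∈ (outside ∷ A) (t       ∷ B) eq = let i , p , q = meets⇒∈ A B eq in fsuc i , there p , there q

¬meets-⊆ : ∀ {A B J : Subset n} → (∀ {i} → i ∈ A → i ∈ J → i ∈ B) → meets B J ≡ false → meets A J ≡ false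
¬meets-⊆ {A = A} {B} {J} A⊆B B∌ with meets A J in eq
... | false = refl
... | true  = let i , p , q = meets⇒∈ A J eq in trans (sym (∈⇒meets (A⊆B p q) q)) B∌

¬meets-∪ : ∀ {A B J : Subset n} → meets A J ≡ false → meets B J ≡ false → meets (A ∪ B) J ≡ false
¬meets-∪ {A = A} {B} {J} A∌ B∌ with meets (A ∪ B) J in eq
... | false = refl
... | true  = let i , p , q = meets⇒∈ (A ∪ B) J eq in
  [ (λ i∈A → trans (sym (∈⇒meets i∈A q)) A∌) , (λ i∈B → trans (sym (∈⇒meets i∈B q)) B∌) ]′ (x∈p∪q⁻ A B p)

cover-≤1 : ∀ (J A : Subset n) → cover J A ≤ 1ℚ
cover-≤1 J A with meets A J
... | true  = ℚ.≤-refl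
... | false = ℚ.nonNegative⁻¹ 1ℚ

0≤cover : ∀ (J A : Subset n) → 0ℚ ≤ cover J A
0≤cover J A with meets A J
... | true  = ℚ.nonNegative⁻¹ 1ℚ
... | false = ℚ.≤-refl

-- If J meets both A and B, the right-hand side is 2. If it meets only one of them, it misses A ∩ B;
-- if it meets neither, it misses A ∪ B as well.
cover-submodular : ∀ (J : Subset n) → Submodular (cover J)
cover-submodular J A B with meets A J in eqA | meets B J in eqB
... | true  | true  = ℚ.+-mono-≤ (cover-≤1 J (A ∪ B)) (cover-≤1 J (A ∩ B))
... | true  | false rewrite ¬meets-⊆ {A = A ∩ B} {B} {J} (λ p _ → p∩q⊆q A B p) eqB = ℚ.+-monoˡ-≤ 0ℚ (cover-≤1 J (A ∪ B))
... | false | true  rewrite ¬meets-⊆ {A = A ∩ B} {A} {J} (λ p _ → p∩q⊆p A B p) eqA =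
  ℚ.≤-trans (ℚ.+-monoˡ-≤ 0ℚ (cover-≤1 J (A ∪ B))) (ℚ.≤-reflexive (ℚ.+-comm 1ℚ 0ℚ))
... | false | false rewrite ¬meets-⊆ {A = A ∩ B} {A} {J} (λ p _ → p∩q⊆p A B p) eqA
                          | ¬meets-∪ {A = A} {B} {J} eqA eqB
  = ℚ.≤-refl

cover-⊥ : ∀ (J : Subset n) → cover J ⊥ ≡ 0ℚ
cover-⊥ J with meets ⊥ J in eq
... | false = refl
... | true  = ⊥-elim (∉⊥ (proj₁ (proj₂ (meets⇒∈ ⊥ J eq))))

singleton-inBase : ∀ {J : Subset n} {j} → j ∈ J → InBase (cover J) (indicator ⁅ j ⁆)
total (singleton-inBase {J = J} {j} j∈J) = trans (wt-singleton j ⊤) (trans (∈⇒indicator {S = ⊤} {j} ∈⊤)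
  (sym (cong (if_then 1ℚ else 0ℚ) (∈⇒meets {A = ⊤} {J} {j} ∈⊤ j∈J))))
bound (singleton-inBase {J = J} {j} j∈J) A = subst (_≤ cover J A) (sym (wt-singleton j A)) le
  where
  le : indicator A j ≤ cover J A
  le with j ∈? A
  ... | yes j∈A = ℚ.≤-reflexive (trans (∈⇒indicator j∈A) (sym (cong (if_then 1ℚ else 0ℚ) (∈⇒meets j∈A j∈J))))
  ... | no j∉A = subst (_≤ cover J A) (sym (∉⇒indicator j∉A)) (0≤cover J A)

-- Along a chain `cover J` jumps once, from 0 to 1, when the first element of J is added. That
-- element names the vertex, and all other increments are 0.
greedy-cover : ∀ (J : Subset n) {S} (c : Chain S) →
    (meets S J ≡ false × greedy (cover J) c ≈ 0v)
  ⊎ (meets S J ≡ true × ∃ λ j → j ∈ J × greedy (cover J) c ≈ indicator ⁅ j ⁆)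
greedy-cover J [] with meets ⊥ J in eq
... | false = inj₁ (refl , λ _ → refl)
... | true  = ⊥-elim (∉⊥ (proj₁ (proj₂ (meets⇒∈ ⊥ J eq))))
greedy-cover J (_▷_ {S} c i) with greedy-cover J c
... | inj₂ (S∋ , j , j∈J , eq) = inj₂ (S∪i∋ , j , j∈J , λ k → trans (cong (λ d → greedy (cover J) c k + d * indicator ⁅ i ⁆ k) Δ≡0)
        (trans (cong (greedy (cover J) c k +_) (ℚ.*-zeroˡ (indicator ⁅ i ⁆ k))) (trans (ℚ.+-identityʳ _) (eq k))))
  where
  S∪i∋ : meets (S ∪ ⁅ i ⁆) J ≡ true
  S∪i∋ = let k , p , q = meets⇒∈ S J S∋ in ∈⇒meets (p⊆p∪q ⁅ i ⁆ p) q
  Δ≡0 : cover J (S ∪ ⁅ i ⁆) - cover J S ≡ 0ℚ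
  Δ≡0 = cong₂ (λ a b → (if a then 1ℚ else 0ℚ) - (if b then 1ℚ else 0ℚ)) S∪i∋ S∋
... | inj₁ (S∌ , eq) with meets (S ∪ ⁅ i ⁆) J in eq′
...   | false = inj₁ (refl , λ k → trans (cong₂ (λ a d → a + d * indicator ⁅ i ⁆ k) (eq k) (cong (λ b → 0ℚ - (if b then 1ℚ else 0ℚ)) S∌))
                  (trans (ℚ.+-identityˡ _) (ℚ.*-zeroˡ (indicator ⁅ i ⁆ k))))
...   | true  = inj₂ (refl , i , i∈J , λ k → trans (cong₂ (λ a d → a + d * indicator ⁅ i ⁆ k) (eq k) (cong (λ b → 1ℚ - (if b then 1ℚ else 0ℚ)) S∌))
                  (trans (ℚ.+-identityˡ _) (ℚ.*-identityˡ (indicator ⁅ i ⁆ k))))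
  where
  i∈J : i ∈ J
  i∈J with meets⇒∈ (S ∪ ⁅ i ⁆) J eq′
  ... | k , p , q with x∈p∪q⁻ S ⁅ i ⁆ p
  ...   | inj₂ k∈i = subst (_∈ J) (x∈⁅y⁆⇒x≡y i k∈i) q
  ...   | inj₁ k∈S with trans (sym (∈⇒meets k∈S q)) S∌
  ...     | ()

simplex-realizes : ∀ {J : Subset n} → Nonempty J → Realizes (simplex J) (cover J)
simplex-realizes {J = J} (j , j∈J) = conv-realizes
  (λ (k , k∈J , v≈) → inBase-resp (λ _ → refl) (λ i → sym (v≈ i)) (singleton-inBase k∈J))
  (λ c → vertex (greedy-cover J c))
  where
  vertex : ∀ {g : Pt _} → (meets ⊤ J ≡ false × g ≈ 0v) ⊎ (meets ⊤ J ≡ true × ∃ λ k → k ∈ J × g ≈ indicator ⁅ k ⁆) →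
    ∃ λ k → k ∈ J × g ≈ indicator ⁅ k ⁆
  vertex (inj₂ (_ , v)) = v
  vertex (inj₁ (⊤∌ , _)) with trans (sym (∈⇒meets {A = ⊤} {J} {j} ∈⊤ j∈J)) ⊤∌
  ... | ()

-- The flag polytope

ι : ℤ → ℚ
ι z = z / 1

ι-+ : ∀ a b → ι (a ℤ.+ b) ≡ ι a + ι b
ι-+ a b = ℚ.toℚᵘ-injective (begin
  toℚᵘ (ι (a ℤ.+ b))                  ≈⟨ ℚ.toℚᵘ-fromℚᵘ (ℚᵘ.mkℚᵘ (a ℤ.+ b) 0) ⟩
  ℚᵘ.mkℚᵘ (a ℤ.+ b) 0                 ≈⟨ ℚᵘ.*≡* (cong (ℤ._* ℤ.+ 1) (cong₂ ℤ._+_ (sym (ℤ.*-identityʳ a)) (sym (ℤ.*-identityʳ b)))) ⟩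
  ℚᵘ.mkℚᵘ a 0 ℚᵘ.+ ℚᵘ.mkℚᵘ b 0        ≈⟨ ℚᵘ.+-cong (ℚᵘ.≃-sym (ℚ.toℚᵘ-fromℚᵘ (ℚᵘ.mkℚᵘ a 0))) (ℚᵘ.≃-sym (ℚ.toℚᵘ-fromℚᵘ (ℚᵘ.mkℚᵘ b 0))) ⟩
  toℚᵘ (ι a) ℚᵘ.+ toℚᵘ (ι b)          ≈⟨ ℚᵘ.≃-sym (ℚ.toℚᵘ-homo-+ (ι a) (ι b)) ⟩
  toℚᵘ (ι a + ι b)                    ∎)
  where open ℚᵘ.≃-Reasoning

0≤ι+ : ∀ k → 0ℚ ≤ ι (ℤ.+ k)
0≤ι+ k = ℚ.nonNegative⁻¹ (ι (ℤ.+ k)) {{ℚ.normalize-nonNeg k 1}}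

ι-mono-≤ : ∀ {k m} → k ℕ.≤ m → ι (ℤ.+ k) ≤ ι (ℤ.+ m)
ι-mono-≤ {k} {m} k≤m = subst₂ _≤_ (ℚ.+-identityʳ (ι (ℤ.+ k)))
  (trans (sym (ι-+ (ℤ.+ k) (ℤ.+ (m ℕ.∸ k)))) (cong (ι ∘ ℤ.+_) (ℕ.m+[n∸m]≡n k≤m)))
  (ℚ.+-monoʳ-≤ (ι (ℤ.+ k)) (0≤ι+ (m ℕ.∸ k)))

sumFin : ∀ m → (Fin m → ℚ) → ℚ
sumFin zero    g = 0ℚ
sumFin (suc m) g = g fzero + sumFin m (g ∘ fsuc)

sumFin-cong : ∀ m {g h : Fin m → ℚ} → (∀ k → g k ≡ h k) → sumFin m g ≡ sumFin m h
sumFin-cong zero    g≗h = refl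
sumFin-cong (suc m) g≗h = cong₂ _+_ (g≗h fzero) (sumFin-cong m (g≗h ∘ fsuc))

sumFin-mono : ∀ m {g h : Fin m → ℚ} → (∀ k → g k ≤ h k) → sumFin m g ≤ sumFin m h
sumFin-mono zero    g≤h = ℚ.≤-refl
sumFin-mono (suc m) g≤h = ℚ.+-mono-≤ (g≤h fzero) (sumFin-mono m (g≤h ∘ fsuc))

sumFin-0 : ∀ m → sumFin m (λ _ → 0ℚ) ≡ 0ℚ
sumFin-0 zero    = refl
sumFin-0 (suc m) = trans (ℚ.+-identityˡ _) (sumFin-0 m)

sumFin-affine : ∀ m (x a b : Fin m → ℚ) e →
  sumFin m (λ k → x k + (b k - a k) * e) ≡ sumFin m x + (sumFin m b - sumFin m a) * e
sumFin-affine zero    x a b e = sym (trans (ℚ.+-identityˡ (0ℚ * e)) (ℚ.*-zeroˡ e))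
sumFin-affine (suc m) x a b e = trans (cong (x fzero + (b fzero - a fzero) * e +_) (sumFin-affine m (x ∘ fsuc) (a ∘ fsuc) (b ∘ fsuc) e))
  (solve 7 (λ x a b X A B e → (x :+ (b :+ :- a) :* e) :+ (X :+ (B :+ :- A) :* e) := (x :+ X) :+ ((b :+ B) :+ :- (a :+ A)) :* e) refl
    (x fzero) (a fzero) (b fzero) (sumFin m (x ∘ fsuc)) (sumFin m (a ∘ fsuc)) (sumFin m (b ∘ fsuc)) e)

wt-sumFin : ∀ m (v : Fin m → Pt n) A → wt (λ j → sumFin m (λ k → v k j)) A ≡ sumFin m (λ k → wt (v k) A)
wt-sumFin zero    v A = wt-0v A
wt-sumFin (suc m) v A = trans (wt-+v (v fzero) (λ j → sumFin m (λ k → v (fsuc k) j)) A)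
  (cong (wt (v fzero) A +_) (wt-sumFin m (v ∘ fsuc) A))

wt-indicator : ∀ (S A : Subset n) → wt (indicator S) A ≡ ι (ℤ.+ ∣ S ∩ A ∣)
wt-indicator []            []            = refl
wt-indicator (inside  ∷ S) (inside  ∷ A) = trans (cong (1ℚ +_) (wt-indicator S A)) (sym (ι-+ (ℤ.+ 1) (ℤ.+ ∣ S ∩ A ∣)))
wt-indicator (inside  ∷ S) (outside ∷ A) = trans (ℚ.+-identityˡ (wt (indicator S) A)) (wt-indicator S A)
wt-indicator (outside ∷ S) (inside  ∷ A) = trans (ℚ.+-identityˡ (wt (indicator S) A)) (wt-indicator S A)
wt-indicator (outside ∷ S) (outside ∷ A) = trans (ℚ.+-identityˡ (wt (indicator S) A)) (wt-indicator S A)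

indicator-∪ : ∀ {S : Subset n} {i} → i ∉ S → ∀ j → indicator (S ∪ ⁅ i ⁆) j ≡ indicator S j + indicator ⁅ i ⁆ j
indicator-∪ {S = S} {i} i∉S j with j ≟ᶠ i
... | yes refl = trans (∈⇒indicator (q⊆p∪q S ⁅ j ⁆ (x∈⁅x⁆ j))) (sym (cong₂ _+_ (∉⇒indicator i∉S) (∈⇒indicator (x∈⁅x⁆ j))))
... | no j≢i with j ∈? S
...   | yes j∈S = trans (∈⇒indicator (p⊆p∪q ⁅ i ⁆ j∈S)) (sym (cong₂ _+_ (∈⇒indicator j∈S) (∉⇒indicator (x≢y⇒x∉⁅y⁆ j≢i))))
...   | no j∉S  = trans (∉⇒indicator {S = S ∪ ⁅ i ⁆} ([ j∉S , j≢i ∘ x∈⁅y⁆⇒x≡y i ]′ ∘ x∈p∪q⁻ S ⁅ i ⁆))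
                    (sym (cong₂ _+_ (∉⇒indicator j∉S) (∉⇒indicator (x≢y⇒x∉⁅y⁆ j≢i))))

⊆∧∣<∣⇒⊂ : ∀ {A B : Subset n} → A ⊆ B → ∣ A ∣ ℕ.< ∣ B ∣ → A ⊂ B
⊆∧∣<∣⇒⊂ {A = A} {B} A⊆B lt with any? (λ j → (j ∈? B) ×-dec ¬? (j ∈? A))
... | yes (j , j∈B , j∉A) = A⊆B , j , j∈B , j∉A
... | no none = ⊥-elim (ℕ.<⇒≱ lt (p⊆q⇒∣p∣≤∣q∣ B⊆A))
  where
  B⊆A : B ⊆ A
  B⊆A {j} j∈B with j ∈? A
  ... | yes j∈A = j∈A
  ... | no j∉A  = ⊥-elim (none (j , j∈B , j∉A))

∣∪∣+∣∩∣ : ∀ (A B : Subset n) → ∣ A ∪ B ∣ ℕ.+ ∣ A ∩ B ∣ ≡ ∣ A ∣ ℕ.+ ∣ B ∣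
∣∪∣+∣∩∣ []            []            = refl
∣∪∣+∣∩∣ (inside  ∷ A) (inside  ∷ B) = cong suc (trans (ℕ.+-suc ∣ A ∪ B ∣ ∣ A ∩ B ∣)
  (trans (cong suc (∣∪∣+∣∩∣ A B)) (sym (ℕ.+-suc ∣ A ∣ ∣ B ∣))))
∣∪∣+∣∩∣ (inside  ∷ A) (outside ∷ B) = cong suc (∣∪∣+∣∩∣ A B)
∣∪∣+∣∩∣ (outside ∷ A) (inside  ∷ B) = trans (cong suc (∣∪∣+∣∩∣ A B)) (sym (ℕ.+-suc ∣ A ∣ ∣ B ∣))
∣∪∣+∣∩∣ (outside ∷ A) (outside ∷ B) = ∣∪∣+∣∩∣ A B

∣∩∣+∣∩∁∣ : ∀ (B A : Subset n) → ∣ B ∩ A ∣ ℕ.+ ∣ B ∩ ∁ A ∣ ≡ ∣ B ∣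
∣∩∣+∣∩∁∣ []            []            = refl
∣∩∣+∣∩∁∣ (inside  ∷ B) (inside  ∷ A) = cong suc (∣∩∣+∣∩∁∣ B A)
∣∩∣+∣∩∁∣ (inside  ∷ B) (outside ∷ A) = trans (ℕ.+-suc ∣ B ∩ A ∣ ∣ B ∩ ∁ A ∣) (cong suc (∣∩∣+∣∩∁∣ B A))
∣∩∣+∣∩∁∣ (outside ∷ B) (_       ∷ A) = ∣∩∣+∣∩∁∣ B A

freeMatroid : ∀ n → Matroid n
rk        (freeMatroid n) = ∣_∣
rk-bound  (freeMatroid n) X = ℕ.≤-refl
rk-mono   (freeMatroid n) = p⊆q⇒∣p∣≤∣q∣
rk-submod (freeMatroid n) X Y = ℕ.≤-reflexive (∣∪∣+∣∩∣ X Y)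

indicatorSum : ∀ m → (Fin m → Subset n) → Pt n
indicatorSum zero    B = 0v
indicatorSum (suc m) B = indicator (B fzero) +v indicatorSum m (B ∘ fsuc)

indicatorSum-sumFin : ∀ m (B : Fin m → Subset n) j → indicatorSum m B j ≡ sumFin m (λ k → indicator (B k) j)
indicatorSum-sumFin zero    B j = refl
indicatorSum-sumFin (suc m) B j = cong (indicator (B fzero) j +_) (indicatorSum-sumFin m (B ∘ fsuc) j)

-- The summation inside flagVec is a local function without a name here, so the left-hand side of partialSum
-- is left to unification, and flagVec-free is what determines it: the rank of the free matroid on suc n
-- elements unfolds to suc ∣ ⊤ ∣, exposing that function at an arbitrary length and family. It does not use
-- the matroid and the flag it is nested under and conversion ignores them, so partialSum covers every matroid.
module _ (C : Fin (suc ∣ ⊤ {n} ∣) → Subset (suc n)) where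

  partialSum : ∀ m (B : Fin m → Subset (suc n)) → _ ≡ indicatorSum m B

  flagVec-free : flagVec (freeMatroid (suc n)) C ≡ indicatorSum (suc ∣ ⊤ {n} ∣) C
  flagVec-free with ∣ ⊤ {n} ∣ | C fzero | (λ k → C (fsuc k))
  ... | m | S | B = cong (indicator S +v_) (partialSum m B)

  partialSum zero    B = refl
  partialSum (suc m) B = cong (indicator (B fzero) +v_) (partialSum m (B ∘ fsuc))

flagVec-sum : ∀ (M : Matroid n) B j → flagVec M B j ≡ sumFin (rank M) (λ k → indicator (B k) j)
-- The empty ground set has no coordinate j. The constant family only instantiates the parameter C
-- under which `partialSum` is declared.
flagVec-sum {suc n} M B j = trans (cong (λ v → v j) (partialSum (λ _ → ⊥) (rank M) B)) (indicatorSum-sumFin (rank M) B j)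

-- The summand at k is the rank function of the truncation of M to rank k + 1.
cappedRank : Matroid n → Subset n → ℚ
cappedRank M A = sumFin (rank M) λ k → ι (ℤ.+ (suc (toℕ k) ⊓ rk M A))

module _ (M : Matroid n) where

  rk-⊥ : rk M ⊥ ≡ 0
  rk-⊥ = ℕ.n≤0⇒n≡0 (subst (rk M ⊥ ℕ.≤_) (∣⊥∣≡0 n) (rk-bound M ⊥))

  rk-∪ : ∀ X Y → rk M (X ∪ Y) ℕ.≤ rk M X ℕ.+ rk M Y
  rk-∪ X Y = ℕ.≤-trans (ℕ.m≤m+n _ _) (rk-submod M X Y)

  -- Splitting B along A gives |B| = r(B) ≤ r(A) + |B - A|, and |B - A| cancels.
  ∣independent∩∣≤rk : ∀ {B} → Independent M B → ∀ A → ∣ B ∩ A ∣ ℕ.≤ rk M A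
  ∣independent∩∣≤rk {B} ind A = ℕ.+-cancelʳ-≤ ∣ B ∩ ∁ A ∣ _ _ (begin
    ∣ B ∩ A ∣ ℕ.+ ∣ B ∩ ∁ A ∣            ≡⟨ ∣∩∣+∣∩∁∣ B A ⟩
    ∣ B ∣                                ≡⟨ sym ind ⟩
    rk M B                               ≤⟨ rk-mono M B⊆ ⟩
    rk M ((B ∩ A) ∪ (B ∩ ∁ A))           ≤⟨ rk-∪ (B ∩ A) (B ∩ ∁ A) ⟩
    rk M (B ∩ A) ℕ.+ rk M (B ∩ ∁ A)      ≤⟨ ℕ.+-mono-≤ (rk-mono M (p∩q⊆q B A)) (rk-bound M (B ∩ ∁ A)) ⟩
    rk M A ℕ.+ ∣ B ∩ ∁ A ∣               ∎)
    where
    open ℕ.≤-Reasoning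
    B⊆ : B ⊆ (B ∩ A) ∪ (B ∩ ∁ A)
    B⊆ {j} j∈B with j ∈? A
    ... | yes j∈A = p⊆p∪q (B ∩ ∁ A) (x∈p∩q⁺ (j∈B , j∈A))
    ... | no j∉A  = q⊆p∪q (B ∩ A) (B ∩ ∁ A) (x∈p∩q⁺ (j∈B , x∉p⇒x∈∁p j∉A))

  -- Each member of the flag contributes |B_k ∩ A|, which is at most |B_k| and at most r(A).
  flag-inBase : ∀ {B} → IsFlag M B → InBase (cappedRank M) (flagVec M B)
  flag-inBase {B} (basis , _) = inBase-resp (λ _ → refl) (λ j → sym (flagVec-sum M B j)) base
    where
    wt≡ : ∀ A → wt (λ j → sumFin (rank M) (λ k → indicator (B k) j)) A ≡ sumFin (rank M) (λ k → ι (ℤ.+ ∣ B k ∩ A ∣))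
    wt≡ A = trans (wt-sumFin (rank M) (λ k → indicator (B k)) A) (sumFin-cong (rank M) (λ k → wt-indicator (B k) A))
    base : InBase (cappedRank M) (λ j → sumFin (rank M) (λ k → indicator (B k) j))
    total base = trans (wt≡ ⊤) (sumFin-cong (rank M) λ k → cong (ι ∘ ℤ.+_)
      (trans (cong ∣_∣ (∩-identityʳ (B k))) (trans (proj₂ (basis k)) (sym (ℕ.m≤n⇒m⊓n≡m (toℕ<n k))))))
    bound base A = subst (_≤ cappedRank M A) (sym (wt≡ A)) (sumFin-mono (rank M) λ k → ι-mono-≤
      (ℕ.⊓-glb (ℕ.≤-trans (∣p∩q∣≤∣p∣ (B k) A) (ℕ.≤-reflexive (proj₂ (basis k)))) (∣independent∩∣≤rk (proj₁ (basis k)) A)))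

  -- The matroid greedy algorithm along the chain: the elements at which the rank rises form a basis
  -- of S, and `member k` consists of the first k of them, or of all if there are fewer. Letting k
  -- range over all naturals keeps the induction free of bounds.
  record Prefix {S} (c : Chain S) : Set where
    field
      member : ℕ → Subset n
      indep  : ∀ k → Independent M (member k)
      size   : ∀ k → ∣ member k ∣ ≡ k ⊓ rk M S
      within : ∀ k → member k ⊆ S
      nested : ∀ k → member k ⊆ member (suc k)
      point  : ∀ j → greedy (cappedRank M) c j ≡ sumFin (rank M) (λ k → indicator (member (suc (toℕ k))) j)
  open Prefix

  prefix-[] : Prefix []
  member prefix-[] k = ⊥
  indep  prefix-[] k = trans rk-⊥ (sym (∣⊥∣≡0 n))
  size   prefix-[] k = trans (∣⊥∣≡0 n) (sym (trans (cong (k ⊓_) rk-⊥) (ℕ.⊓-zeroʳ k)))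
  within prefix-[] k = id
  nested prefix-[] k = id
  point  prefix-[] j = sym (trans (sumFin-cong (rank M) (λ _ → indicator-⊥ j)) (sumFin-0 (rank M)))

  prefix-same : ∀ {S} {c : Chain S} {i} → rk M (S ∪ ⁅ i ⁆) ≡ rk M S → Prefix c → Prefix (c ▷ i)
  member (prefix-same eq p) = member p
  indep  (prefix-same eq p) = indep p
  size   (prefix-same eq p) k = trans (size p k) (cong (k ⊓_) (sym eq))
  within (prefix-same {i = i} eq p) k = p⊆p∪q ⁅ i ⁆ ∘ within p k
  nested (prefix-same eq p) = nested p
  point  (prefix-same {S} {c} {i} eq p) j = trans
    (cong (λ r → greedy (cappedRank M) c j + (sumFin (rank M) (λ k → ι (ℤ.+ (suc (toℕ k) ⊓ r))) - cappedRank M S) * indicator ⁅ i ⁆ j) eq)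
    (trans (cong (λ d → greedy (cappedRank M) c j + d * indicator ⁅ i ⁆ j) (ℚ.+-inverseʳ (cappedRank M S)))
      (trans (cong (greedy (cappedRank M) c j +_) (ℚ.*-zeroˡ (indicator ⁅ i ⁆ j))) (trans (ℚ.+-identityʳ _) (point p j))))

  -- When i raises the rank from ρ to ρ + 1, it joins precisely the members with k > ρ, since those
  -- with k ≤ ρ already have k elements. These are also the k for which min(k, r(S)) grows, by 1
  -- each, so the greedy point and the sum of indicators change alike.
  module Augment {S} {c : Chain S} {i} (jump : rk M (S ∪ ⁅ i ⁆) ≡ suc (rk M S)) (p : Prefix c) where

    private
      ρ = rk M S

      i∉S : i ∉ S
      i∉S i∈S = ℕ.1+n≢n (trans (sym jump) (cong (rk M) (⊆-antisym
        (λ {j} j∈ → [ id , (λ j∈i → subst (_∈ S) (sym (x∈⁅y⁆⇒x≡y i j∈i)) i∈S) ]′ (x∈p∪q⁻ S ⁅ i ⁆ j∈)) (p⊆p∪q ⁅ i ⁆))))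

      -- The decision is an argument so that the facts below can be proved by matching on it.
      add : ∀ k → Dec (k ℕ.≤ ρ) → Subset n
      add k (yes _) = member p k
      add k (no _)  = member p k ∪ ⁅ i ⁆

      ρ<k⇒size : ∀ {k} → ρ ℕ.< k → ∣ member p k ∣ ≡ ρ
      ρ<k⇒size {k} ρ<k = trans (size p k) (ℕ.m≥n⇒m⊓n≡n (ℕ.<⇒≤ ρ<k))

      -- For k > ρ the member B is a basis of S. Submodularity for B ∪ {i} and S applies: their
      -- union contains S ∪ {i}, of rank ρ + 1, and their intersection contains B, of rank ρ.
      augmented : ∀ {k} → ρ ℕ.< k → suc ρ ℕ.≤ rk M (member p k ∪ ⁅ i ⁆)
      augmented {k} ρ<k = ℕ.+-cancelʳ-≤ ρ _ _ (begin
        suc ρ ℕ.+ ρ                                     ≡⟨ cong₂ ℕ._+_ (sym jump) (sym (trans (indep p k) (ρ<k⇒size ρ<k))) ⟩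
        rk M (S ∪ ⁅ i ⁆) ℕ.+ rk M B                     ≤⟨ ℕ.+-mono-≤ (rk-mono M S∪i⊆) (rk-mono M B⊆) ⟩
        rk M ((B ∪ ⁅ i ⁆) ∪ S) ℕ.+ rk M ((B ∪ ⁅ i ⁆) ∩ S) ≤⟨ rk-submod M (B ∪ ⁅ i ⁆) S ⟩
        rk M (B ∪ ⁅ i ⁆) ℕ.+ ρ                          ∎)
        where
        open ℕ.≤-Reasoning
        B = member p k
        S∪i⊆ : S ∪ ⁅ i ⁆ ⊆ (B ∪ ⁅ i ⁆) ∪ S
        S∪i⊆ j∈ = [ q⊆p∪q (B ∪ ⁅ i ⁆) S , p⊆p∪q S ∘ q⊆p∪q B ⁅ i ⁆ ]′ (x∈p∪q⁻ S ⁅ i ⁆ j∈)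
        B⊆ : B ⊆ (B ∪ ⁅ i ⁆) ∩ S
        B⊆ j∈ = x∈p∩q⁺ (p⊆p∪q ⁅ i ⁆ j∈ , within p k j∈)

      ∣augmented∣≤ : ∀ {k} → ρ ℕ.< k → ∣ member p k ∪ ⁅ i ⁆ ∣ ℕ.≤ suc ρ
      ∣augmented∣≤ {k} ρ<k = begin
        ∣ B ∪ ⁅ i ⁆ ∣                        ≤⟨ ℕ.m≤m+n _ _ ⟩
        ∣ B ∪ ⁅ i ⁆ ∣ ℕ.+ ∣ B ∩ ⁅ i ⁆ ∣      ≡⟨ ∣∪∣+∣∩∣ B ⁅ i ⁆ ⟩
        ∣ B ∣ ℕ.+ ∣ ⁅ i ⁆ ∣                  ≡⟨ cong₂ ℕ._+_ (ρ<k⇒size ρ<k) (∣⁅x⁆∣≡1 i) ⟩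
        ρ ℕ.+ 1                              ≡⟨ ℕ.+-comm ρ 1 ⟩
        suc ρ                                ∎
        where
        open ℕ.≤-Reasoning
        B = member p k

      add-indep : ∀ k d → Independent M (add k d)
      add-indep k (yes _)  = indep p k
      add-indep k (no k≰ρ) = ℕ.≤-antisym (rk-bound M _) (ℕ.≤-trans (∣augmented∣≤ (ℕ.≰⇒> k≰ρ)) (augmented (ℕ.≰⇒> k≰ρ)))

      add-size : ∀ k d → ∣ add k d ∣ ≡ k ⊓ suc ρ
      add-size k (yes k≤ρ) = trans (size p k) (trans (ℕ.m≤n⇒m⊓n≡m k≤ρ) (sym (ℕ.m≤n⇒m⊓n≡m (ℕ.m≤n⇒m≤1+n k≤ρ))))
      add-size k (no k≰ρ)  = trans
        (ℕ.≤-antisym (∣augmented∣≤ (ℕ.≰⇒> k≰ρ)) (ℕ.≤-trans (augmented (ℕ.≰⇒> k≰ρ)) (rk-bound M _)))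
        (sym (ℕ.m≥n⇒m⊓n≡n (ℕ.≰⇒> k≰ρ)))

      add-within : ∀ k d → add k d ⊆ S ∪ ⁅ i ⁆
      add-within k (yes _) j∈ = p⊆p∪q ⁅ i ⁆ (within p k j∈)
      add-within k (no _)  j∈ = [ p⊆p∪q ⁅ i ⁆ ∘ within p k , q⊆p∪q S ⁅ i ⁆ ]′ (x∈p∪q⁻ (member p k) ⁅ i ⁆ j∈)

      add-nested : ∀ k d d′ → add k d ⊆ add (suc k) d′
      add-nested k (yes _)  (yes _) j∈ = nested p k j∈
      add-nested k (yes _)  (no _)  j∈ = p⊆p∪q ⁅ i ⁆ (nested p k j∈)
      add-nested k (no k≰ρ) (yes k<ρ) j∈ = ⊥-elim (k≰ρ (ℕ.<⇒≤ k<ρ))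
      add-nested k (no _)   (no _)  j∈ =
        [ p⊆p∪q ⁅ i ⁆ ∘ nested p k , q⊆p∪q (member p (suc k)) ⁅ i ⁆ ]′ (x∈p∪q⁻ (member p k) ⁅ i ⁆ j∈)

      add-indicator : ∀ k d j → indicator (add k d) j ≡
        indicator (member p k) j + (ι (ℤ.+ (k ⊓ suc ρ)) - ι (ℤ.+ (k ⊓ ρ))) * indicator ⁅ i ⁆ j
      add-indicator k (yes k≤ρ) j = sym (trans
        (cong (λ d → indicator (member p k) j + d * indicator ⁅ i ⁆ j) (trans
          (cong₂ (λ a b → ι (ℤ.+ a) - ι (ℤ.+ b)) (ℕ.m≤n⇒m⊓n≡m (ℕ.m≤n⇒m≤1+n k≤ρ)) (ℕ.m≤n⇒m⊓n≡m k≤ρ))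
          (ℚ.+-inverseʳ (ι (ℤ.+ k)))))
        (trans (cong (indicator (member p k) j +_) (ℚ.*-zeroˡ (indicator ⁅ i ⁆ j))) (ℚ.+-identityʳ _)))
      add-indicator k (no k≰ρ) j = trans (indicator-∪ (i∉S ∘ within p k) j) (sym (cong (indicator (member p k) j +_)
        (trans (cong (_* indicator ⁅ i ⁆ j) Δ≡1) (ℚ.*-identityˡ (indicator ⁅ i ⁆ j)))))
        where
        ρ<k = ℕ.≰⇒> k≰ρ
        Δ≡1 : ι (ℤ.+ (k ⊓ suc ρ)) - ι (ℤ.+ (k ⊓ ρ)) ≡ 1ℚ
        Δ≡1 = trans (cong₂ (λ a b → ι (ℤ.+ a) - ι (ℤ.+ b)) (ℕ.m≥n⇒m⊓n≡n ρ<k) (ℕ.m≥n⇒m⊓n≡n (ℕ.<⇒≤ ρ<k)))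
          (trans (cong (_- ι (ℤ.+ ρ)) (ι-+ (ℤ.+ 1) (ℤ.+ ρ)))
            (solve 1 (λ r → (con 1ℚ :+ r) :+ :- r := con 1ℚ) refl (ι (ℤ.+ ρ))))

    augment : Prefix (c ▷ i)
    member augment k = add k (k ℕ.≤? ρ)
    indep  augment k = add-indep k (k ℕ.≤? ρ)
    size   augment k = trans (add-size k (k ℕ.≤? ρ)) (cong (k ⊓_) (sym jump))
    within augment k = add-within k (k ℕ.≤? ρ)
    nested augment k = add-nested k (k ℕ.≤? ρ) (suc k ℕ.≤? ρ)
    point  augment j = begin
      greedy (cappedRank M) c j + (cappedRank M (S ∪ ⁅ i ⁆) - cappedRank M S) * e
        ≡⟨ cong₂ (λ x r → x + (sumFin (rank M) (λ k → ι (ℤ.+ (suc (toℕ k) ⊓ r))) - cappedRank M S) * e) (point p j) jump ⟩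
      sumFin (rank M) old + (sumFin (rank M) after - cappedRank M S) * e
        ≡⟨ sumFin-affine (rank M) old (λ k → ι (ℤ.+ (suc (toℕ k) ⊓ ρ))) after e ⟨
      sumFin (rank M) (λ k → old k + (after k - ι (ℤ.+ (suc (toℕ k) ⊓ ρ))) * e)
        ≡⟨ sumFin-cong (rank M) (λ k → sym (add-indicator (suc (toℕ k)) (suc (toℕ k) ℕ.≤? ρ) j)) ⟩
      sumFin (rank M) (λ k → indicator (member augment (suc (toℕ k))) j) ∎
      where
      open ≡-Reasoning
      e = indicator ⁅ i ⁆ j
      old after : Fin (rank M) → ℚ
      old k   = indicator (member p (suc (toℕ k))) j
      after k = ι (ℤ.+ (suc (toℕ k) ⊓ suc ρ))

  prefix : ∀ {S} (c : Chain S) → Prefix c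
  prefix []            = prefix-[]
  prefix (_▷_ {S} c i) with rk M (S ∪ ⁅ i ⁆) ℕ.≟ rk M S
  ... | yes eq = prefix-same eq (prefix c)
  ... | no neq = Augment.augment (ℕ.≤-antisym le (ℕ.≤∧≢⇒< (rk-mono M (p⊆p∪q ⁅ i ⁆)) (neq ∘ sym))) (prefix c)
    where
    le : rk M (S ∪ ⁅ i ⁆) ℕ.≤ suc (rk M S)
    le = ℕ.≤-trans (rk-∪ S ⁅ i ⁆) (ℕ.≤-trans
      (ℕ.+-monoʳ-≤ (rk M S) (ℕ.≤-trans (rk-bound M ⁅ i ⁆) (ℕ.≤-reflexive (∣⁅x⁆∣≡1 i)))) (ℕ.≤-reflexive (ℕ.+-comm (rk M S) 1)))

  prefix-flag : ∀ {c : Chain (⊤ {n})} (p : Prefix c) → IsFlag M (λ k → member p (suc (toℕ k)))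
  prefix-flag p = (λ k → indep p (suc (toℕ k)) , sizes k) , λ k l l≡ →
      ⊆∧∣<∣⇒⊂ (subst (λ m → member p (suc (toℕ k)) ⊆ member p (suc m)) (sym l≡) (nested p (suc (toℕ k))))
        (ℕ.≤-reflexive (trans (cong suc (sizes k)) (trans (cong suc (sym l≡)) (sym (sizes l)))))
    where
    sizes : ∀ k → ∣ member p (suc (toℕ k)) ∣ ≡ suc (toℕ k)
    sizes k = trans (size p (suc (toℕ k))) (ℕ.m≤n⇒m⊓n≡m (toℕ<n k))

  flagPolytope-realizes : Realizes (flagPolytope M) (cappedRank M)
  flagPolytope-realizes = conv-realizes
    (λ (B , flag , v≈) → inBase-resp (λ _ → refl) (λ j → sym (v≈ j)) (flag-inBase flag))
    (λ c → let p = prefix c in (λ k → member p (suc (toℕ k))) , prefix-flag p ,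
       λ j → trans (point p j) (sym (flagVec-sum M (λ k → member p (suc (toℕ k))) j)))

-- Signed gamma invariants of contractions

sumℤ : ∀ {A : Set} → (A → ℤ) → List A → ℤ
sumℤ g []       = ℤ.+ 0
sumℤ g (x ∷ xs) = g x ℤ.+ sumℤ g xs

module _ {A : Set} where

  sumℤ-cong : ∀ {g h : A → ℤ} → (∀ x → g x ≡ h x) → ∀ xs → sumℤ g xs ≡ sumℤ h xs
  sumℤ-cong g≗h []       = refl
  sumℤ-cong g≗h (x ∷ xs) = cong₂ ℤ._+_ (g≗h x) (sumℤ-cong g≗h xs)

  sumℤ-++ : ∀ (g : A → ℤ) xs ys → sumℤ g (xs ++ ys) ≡ sumℤ g xs ℤ.+ sumℤ g ys
  sumℤ-++ g []       ys = sym (ℤ.+-identityˡ _)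
  sumℤ-++ g (x ∷ xs) ys = trans (cong (λ s → g x ℤ.+ s) (sumℤ-++ g xs ys)) (sym (ℤ.+-assoc (g x) _ _))

  sumℤ-map : ∀ {B : Set} (g : A → ℤ) (f : B → A) xs → sumℤ g (map f xs) ≡ sumℤ (g ∘ f) xs
  sumℤ-map g f []       = refl
  sumℤ-map g f (x ∷ xs) = cong (λ s → g (f x) ℤ.+ s) (sumℤ-map g f xs)

  sumℤ-* : ∀ c (g : A → ℤ) xs → c ℤ.* sumℤ g xs ≡ sumℤ (λ x → c ℤ.* g x) xs
  sumℤ-* c g []       = ℤ.*-zeroʳ c
  sumℤ-* c g (x ∷ xs) = trans (ℤ.*-distribˡ-+ c (g x) (sumℤ g xs)) (cong (λ s → c ℤ.* g x ℤ.+ s) (sumℤ-* c g xs))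

  sumℤ-- : ∀ (g h : A → ℤ) xs → sumℤ g xs ℤ.- sumℤ h xs ≡ sumℤ (λ x → g x ℤ.- h x) xs
  sumℤ-- g h []       = refl
  sumℤ-- g h (x ∷ xs) = trans (lem (g x) (h x) (sumℤ g xs) (sumℤ h xs)) (cong (λ s → (g x ℤ.- h x) ℤ.+ s) (sumℤ-- g h xs))
    where
    lem : ∀ a b s t → (a ℤ.+ s) ℤ.- (b ℤ.+ t) ≡ (a ℤ.- b) ℤ.+ (s ℤ.- t)
    lem = solve-∀

  sumℤ-filter : ∀ {P : Pred A 0ℓ} (P? : Decidable P) (g : A → ℤ) → (∀ x → ¬ P x → g x ≡ ℤ.+ 0) → ∀ xs →
    sumℤ g (filter P? xs) ≡ sumℤ g xs
  sumℤ-filter P? g g≡0 []       = refl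
  sumℤ-filter P? g g≡0 (x ∷ xs) with P? x
  ... | yes _ = cong (λ s → g x ℤ.+ s) (sumℤ-filter P? g g≡0 xs)
  ... | no ¬p = trans (sumℤ-filter P? g g≡0 xs) (sym (trans (cong (ℤ._+ sumℤ g xs) (g≡0 x ¬p)) (ℤ.+-identityˡ _)))

sign : ℕ → ℤ
sign zero    = ℤ.+ 1
sign (suc k) = ℤ.- sign k

sign-+ : ∀ k m → sign (k ℕ.+ m) ≡ sign k ℤ.* sign m
sign-+ zero    m = sym (ℤ.*-identityˡ (sign m))
sign-+ (suc k) m = trans (cong ℤ.-_ (sign-+ k m)) (ℤ.neg-distribˡ-* (sign k) (sign m))

sign-* : ∀ k → sign k ℤ.* sign k ≡ ℤ.+ 1
sign-* zero    = refl
sign-* (suc k) = trans (lem (sign k)) (sign-* k)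
  where
  lem : ∀ s → (ℤ.- s) ℤ.* (ℤ.- s) ≡ s ℤ.* s
  lem = solve-∀

-- The local sign function of signedGamma is determined by unification in the same way; replacing Sign._*_ by
-- a variable lets the unifier decompose the product.
module _ (N : RankData n) where

  sgn≡sign : ∀ k → _ ≡ sign k

  signedGamma-sign : signedGamma N ≡ sign (rkD N (ground N)) ℤ.* gamma N
  signedGamma-sign with rkD N (ground N) | Sign._*_ | gamma N
  ... | k | _∙_ | g = cong (λ s → (ℤ.sign s ∙ ℤ.sign g) ℤ.◃ (ℤ.∣ s ∣ ℕ.* ℤ.∣ g ∣)) (sgn≡sign k)

  sgn≡sign zero    = refl
  sgn≡sign (suc k) = cong ℤ.-_ (sgn≡sign k)

-- Low coefficients of the Tutte polynomial

tri : ℕ → ℕ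
tri zero    = 0
tri (suc k) = suc k ℕ.+ tri k

x-1 y-1 : ℕ → Poly2
x-1 k = (X -P 1P) ^P k
y-1 k = (Y -P 1P) ^P k

x-1-coeff₀ : ∀ k → x-1 k 0 0 ≡ sign k
x-1-coeff₀ zero    = refl
x-1-coeff₀ (suc k) = trans (ℤ.-1*i≡-i (x-1 k 0 0)) (cong ℤ.-_ (x-1-coeff₀ k))

x-1-coeff₁ : ∀ k → x-1 k 1 0 ≡ ℤ.- (sign k ℤ.* ℤ.+ k)
x-1-coeff₁ zero    = refl
x-1-coeff₁ (suc k) = trans (cong₂ (λ a b → ℤ.- (ℤ.+ 1) ℤ.* a ℤ.+ ℤ.+ 1 ℤ.* b) (x-1-coeff₁ k) (x-1-coeff₀ k))
  (lem (sign k) (ℤ.+ k))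
  where
  lem : ∀ s k → ℤ.- (ℤ.+ 1) ℤ.* (ℤ.- (s ℤ.* k)) ℤ.+ ℤ.+ 1 ℤ.* s ≡ ℤ.- ((ℤ.- s) ℤ.* (ℤ.+ 1 ℤ.+ k))
  lem = solve-∀

-- In (x - 1)^k the coefficients of x^2 and x are (-1)^k C(k,2) and -(-1)^k k, and C(k,2) + k =
-- C(k+1,2). This is the origin of the triangular numbers.
x-1-coeff₂₋₁ : ∀ k → x-1 k 2 0 ℤ.- x-1 k 1 0 ≡ sign k ℤ.* ℤ.+ tri k
x-1-coeff₂₋₁ zero    = refl
x-1-coeff₂₋₁ (suc k) = begin
  ((ℤ.- (ℤ.+ 1) ℤ.* c₂ ℤ.+ ℤ.+ 1 ℤ.* c₁) ℤ.+ ℤ.+ 0 ℤ.* c₀) ℤ.- (ℤ.- (ℤ.+ 1) ℤ.* c₁ ℤ.+ ℤ.+ 1 ℤ.* c₀)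
    ≡⟨ lem₁ c₂ c₁ c₀ ⟩
  (ℤ.- (c₂ ℤ.- c₁)) ℤ.+ (c₁ ℤ.- c₀)
    ≡⟨ cong₂ (λ a b → (ℤ.- a) ℤ.+ b) (x-1-coeff₂₋₁ k) (cong₂ ℤ._-_ (x-1-coeff₁ k) (x-1-coeff₀ k)) ⟩
  (ℤ.- (sign k ℤ.* ℤ.+ tri k)) ℤ.+ ((ℤ.- (sign k ℤ.* ℤ.+ k)) ℤ.- sign k)
    ≡⟨ lem₂ (sign k) (ℤ.+ tri k) (ℤ.+ k) ⟩
  (ℤ.- sign k) ℤ.* ((ℤ.+ 1 ℤ.+ ℤ.+ k) ℤ.+ ℤ.+ tri k) ∎
  where
  open ≡-Reasoning
  c₂ = x-1 k 2 0
  c₁ = x-1 k 1 0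
  c₀ = x-1 k 0 0
  lem₁ : ∀ c₂ c₁ c₀ → ((ℤ.- (ℤ.+ 1) ℤ.* c₂ ℤ.+ ℤ.+ 1 ℤ.* c₁) ℤ.+ ℤ.+ 0 ℤ.* c₀) ℤ.- (ℤ.- (ℤ.+ 1) ℤ.* c₁ ℤ.+ ℤ.+ 1 ℤ.* c₀)
    ≡ (ℤ.- (c₂ ℤ.- c₁)) ℤ.+ (c₁ ℤ.- c₀)
  lem₁ = solve-∀
  lem₂ : ∀ s t k → (ℤ.- (s ℤ.* t)) ℤ.+ ((ℤ.- (s ℤ.* k)) ℤ.- s) ≡ (ℤ.- s) ℤ.* ((ℤ.+ 1 ℤ.+ k) ℤ.+ t)
  lem₂ = solve-∀

y-1-coeff₀ : ∀ k → y-1 k 0 0 ≡ sign k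
y-1-coeff₀ zero    = refl
y-1-coeff₀ (suc k) = trans (ℤ.-1*i≡-i (y-1 k 0 0)) (cong ℤ.-_ (y-1-coeff₀ k))

y-1-coeff₁ : ∀ k → y-1 k 1 0 ≡ ℤ.+ 0
y-1-coeff₁ zero    = refl
y-1-coeff₁ (suc k) = trans (cong (λ a → ℤ.- (ℤ.+ 1) ℤ.* a ℤ.+ ℤ.+ 0 ℤ.* y-1 k 0 0) (y-1-coeff₁ k)) (lem (y-1 k 0 0))
  where
  lem : ∀ a → ℤ.- (ℤ.+ 1) ℤ.* ℤ.+ 0 ℤ.+ ℤ.+ 0 ℤ.* a ≡ ℤ.+ 0
  lem = solve-∀

y-1-coeff₂ : ∀ k → y-1 k 2 0 ≡ ℤ.+ 0
y-1-coeff₂ zero    = refl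
y-1-coeff₂ (suc k) = trans
  (cong (λ a → (ℤ.- (ℤ.+ 1) ℤ.* a ℤ.+ ℤ.+ 0 ℤ.* y-1 k 1 0) ℤ.+ ℤ.+ 0 ℤ.* y-1 k 0 0) (y-1-coeff₂ k))
  (lem (y-1 k 1 0) (y-1 k 0 0))
  where
  lem : ∀ b a → (ℤ.- (ℤ.+ 1) ℤ.* ℤ.+ 0 ℤ.+ ℤ.+ 0 ℤ.* b) ℤ.+ ℤ.+ 0 ℤ.* a ≡ ℤ.+ 0
  lem = solve-∀

tutteTerm : ℕ → ℕ → Poly2
tutteTerm k l = ((X -P 1P) ^P k) *P ((Y -P 1P) ^P l)

-- Only terms free of y are read off, so the factor (y - 1)^l enters through its constant term.
tutteTerm-gamma : ∀ k l → tutteTerm k l 2 0 ℤ.- tutteTerm k l 1 0 ≡ sign k ℤ.* ℤ.+ tri k ℤ.* sign l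
tutteTerm-gamma k l = trans
  (cong₂ (λ q₂ q₁ → ((p₀ ℤ.* q₂ ℤ.+ p₁ ℤ.* q₁) ℤ.+ p₂ ℤ.* q₀) ℤ.- (p₀ ℤ.* q₁ ℤ.+ p₁ ℤ.* q₀)) (y-1-coeff₂ l) (y-1-coeff₁ l))
  (trans (lem p₀ p₁ p₂ q₀) (cong₂ ℤ._*_ (x-1-coeff₂₋₁ k) (y-1-coeff₀ l)))
  where
  p₀ = x-1 k 0 0
  p₁ = x-1 k 1 0
  p₂ = x-1 k 2 0
  q₀ = y-1 l 0 0
  lem : ∀ p₀ p₁ p₂ q₀ → ((p₀ ℤ.* ℤ.+ 0 ℤ.+ p₁ ℤ.* ℤ.+ 0) ℤ.+ p₂ ℤ.* q₀) ℤ.- (p₀ ℤ.* ℤ.+ 0 ℤ.+ p₁ ℤ.* q₀) ≡ (p₂ ℤ.- p₁) ℤ.* q₀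
  lem = solve-∀

sumP-sumℤ : ∀ {A : Set} (t : A → Poly2) i j xs → sumP (map t xs) i j ≡ sumℤ (λ x → t x i j) xs
sumP-sumℤ t i j []       = refl
sumP-sumℤ t i j (x ∷ xs) = cong (λ s → t x i j ℤ.+ s) (sumP-sumℤ t i j xs)

-- The signs collapse: with R the rank, (-1)^R (-1)^(R-r(A)) (-1)^(|A|-r(A)) = (-1)^|A|. The two
-- hypotheses make the truncated subtractions exact.
signedGamma-sum : ∀ (N : RankData n) → (∀ A → rkD N A ℕ.≤ rkD N (ground N)) → (∀ A → rkD N A ℕ.≤ ∣ A ∣) →
  signedGamma N ≡ sumℤ (λ A → sign ∣ A ∣ ℤ.* ℤ.+ tri (rkD N (ground N) ∸ rkD N A)) (subsetsOf (ground N))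
signedGamma-sum {n} N ≤R ≤∣∣ = begin
  signedGamma N
    ≡⟨ signedGamma-sign N ⟩
  sign R ℤ.* (tutte N 2 0 ℤ.- tutte N 1 0)
    ≡⟨ cong (λ g → sign R ℤ.* g) (cong₂ ℤ._-_ (sumP-sumℤ term 2 0 As) (sumP-sumℤ term 1 0 As)) ⟩
  sign R ℤ.* (sumℤ (λ A → term A 2 0) As ℤ.- sumℤ (λ A → term A 1 0) As)
    ≡⟨ cong (λ g → sign R ℤ.* g) (sumℤ-- (λ A → term A 2 0) (λ A → term A 1 0) As) ⟩
  sign R ℤ.* sumℤ (λ A → term A 2 0 ℤ.- term A 1 0) As
    ≡⟨ sumℤ-* (sign R) (λ A → term A 2 0 ℤ.- term A 1 0) As ⟩
  sumℤ (λ A → sign R ℤ.* (term A 2 0 ℤ.- term A 1 0)) As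
    ≡⟨ sumℤ-cong signs As ⟩
  sumℤ (λ A → sign ∣ A ∣ ℤ.* ℤ.+ tri (R ∸ rkD N A)) As ∎
  where
  open ≡-Reasoning
  R = rkD N (ground N)
  As = subsetsOf (ground N)
  term : Subset n → Poly2
  term A = tutteTerm (R ∸ rkD N A) (∣ A ∣ ∸ rkD N A)
  lem : ∀ k r t l → (k ℤ.* r) ℤ.* (k ℤ.* t ℤ.* l) ≡ (k ℤ.* k) ℤ.* ((l ℤ.* r) ℤ.* t)
  lem = solve-∀
  signs : ∀ A → sign R ℤ.* (term A 2 0 ℤ.- term A 1 0) ≡ sign ∣ A ∣ ℤ.* ℤ.+ tri (R ∸ rkD N A)
  signs A = begin
    sign R ℤ.* (term A 2 0 ℤ.- term A 1 0)
      ≡⟨ cong₂ ℤ._*_ (trans (cong sign (sym (ℕ.m∸n+n≡m (≤R A)))) (sign-+ k r)) (tutteTerm-gamma k l) ⟩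
    (sign k ℤ.* sign r) ℤ.* (sign k ℤ.* ℤ.+ tri k ℤ.* sign l)
      ≡⟨ lem (sign k) (sign r) (ℤ.+ tri k) (sign l) ⟩
    (sign k ℤ.* sign k) ℤ.* ((sign l ℤ.* sign r) ℤ.* ℤ.+ tri k)
      ≡⟨ cong₂ (λ a b → a ℤ.* (b ℤ.* ℤ.+ tri k)) (sign-* k) (trans (sym (sign-+ l r)) (cong sign (ℕ.m∸n+n≡m (≤∣∣ A)))) ⟩
    ℤ.+ 1 ℤ.* (sign ∣ A ∣ ℤ.* ℤ.+ tri k)
      ≡⟨ ℤ.*-identityˡ _ ⟩
    sign ∣ A ∣ ℤ.* ℤ.+ tri k ∎
    where
    r = rkD N A
    k = R ∸ r
    l = ∣ A ∣ ∸ r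

-- Möbius inversion on the lattice of subsets

filter-map : ∀ {A B : Set} {P : Pred A 0ℓ} {R : Pred B 0ℓ} (P? : Decidable P) (R? : Decidable R) (f : B → A) →
  (∀ x → does (P? (f x)) ≡ does (R? x)) → ∀ xs → filter P? (map f xs) ≡ map f (filter R? xs)
filter-map P? R? f eq []       = refl
filter-map P? R? f eq (x ∷ xs) with does (P? (f x)) | does (R? x) | eq x
... | true  | true  | _ = cong (f x ∷_) (filter-map P? R? f eq xs)
... | false | false | _ = filter-map P? R? f eq xs

subsetsOf-outside : ∀ (S : Subset n) → subsetsOf (outside ∷ S) ≡ map (outside ∷_) (subsetsOf S)
subsetsOf-outside {n} S = trans (filter-++ (_⊆? (outside ∷ S)) (map (inside ∷_) (allSubsets n)) _)
  (cong₂ _++_ (none (allSubsets n)) (filter-map (_⊆? (outside ∷ S)) (_⊆? S) (outside ∷_) (λ _ → refl) (allSubsets n)))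
  where
  none : ∀ xs → filter (_⊆? (outside ∷ S)) (map (inside ∷_) xs) ≡ []
  none []       = refl
  none (x ∷ xs) = none xs

subsetsOf-inside : ∀ (S : Subset n) → subsetsOf (inside ∷ S) ≡ map (inside ∷_) (subsetsOf S) ++ map (outside ∷_) (subsetsOf S)
subsetsOf-inside {n} S = trans (filter-++ (_⊆? (inside ∷ S)) (map (inside ∷_) (allSubsets n)) _)
  (cong₂ _++_ (filter-map (_⊆? (inside ∷ S)) (_⊆? S) (inside ∷_) (λ _ → refl) (allSubsets n))
              (filter-map (_⊆? (inside ∷ S)) (_⊆? S) (outside ∷_) (λ _ → refl) (allSubsets n)))

-- With B = A ∪ I this is the sum of (-1)^|B-I| h(B) over all B containing I. It runs over subsets
-- of the complement to match the Tutte sum of a contraction.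
möbius : (Subset n → ℤ) → Subset n → ℤ
möbius h I = sumℤ (λ A → sign ∣ A ∣ ℤ.* h (A ∪ I)) (subsetsOf (∁ I))

möbius-inside : ∀ (h : Subset (suc n) → ℤ) I → möbius h (inside ∷ I) ≡ möbius (h ∘ (inside ∷_)) I
möbius-inside h I = trans (cong (sumℤ _) (subsetsOf-outside (∁ I))) (sumℤ-map _ (outside ∷_) (subsetsOf (∁ I)))

möbius-outside : ∀ (h : Subset (suc n) → ℤ) I →
  möbius h (outside ∷ I) ≡ möbius (h ∘ (outside ∷_)) I ℤ.- möbius (h ∘ (inside ∷_)) I
möbius-outside h I = begin
  sumℤ g (subsetsOf (inside ∷ ∁ I))
    ≡⟨ cong (sumℤ g) (subsetsOf-inside (∁ I)) ⟩
  sumℤ g (map (inside ∷_) As ++ map (outside ∷_) As)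
    ≡⟨ sumℤ-++ g (map (inside ∷_) As) (map (outside ∷_) As) ⟩
  sumℤ g (map (inside ∷_) As) ℤ.+ sumℤ g (map (outside ∷_) As)
    ≡⟨ cong₂ ℤ._+_ (sumℤ-map g (inside ∷_) As) (sumℤ-map g (outside ∷_) As) ⟩
  sumℤ (λ A → (ℤ.- sign ∣ A ∣) ℤ.* h (inside ∷ (A ∪ I))) As ℤ.+ möbius (h ∘ (outside ∷_)) I
    ≡⟨ cong (ℤ._+ möbius (h ∘ (outside ∷_)) I) (trans (sumℤ-cong (λ A → lem (sign ∣ A ∣) (h (inside ∷ (A ∪ I)))) As)
         (sym (sumℤ-* (ℤ.- (ℤ.+ 1)) (λ A → sign ∣ A ∣ ℤ.* h (inside ∷ (A ∪ I))) As))) ⟩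
  ℤ.- (ℤ.+ 1) ℤ.* möbius (h ∘ (inside ∷_)) I ℤ.+ möbius (h ∘ (outside ∷_)) I
    ≡⟨ lem′ (möbius (h ∘ (inside ∷_)) I) (möbius (h ∘ (outside ∷_)) I) ⟩
  möbius (h ∘ (outside ∷_)) I ℤ.- möbius (h ∘ (inside ∷_)) I ∎
  where
  open ≡-Reasoning
  As = subsetsOf (∁ I)
  g = λ A → sign ∣ A ∣ ℤ.* h (A ∪ (outside ∷ I))
  lem : ∀ s x → (ℤ.- s) ℤ.* x ≡ ℤ.- (ℤ.+ 1) ℤ.* (s ℤ.* x)
  lem = solve-∀
  lem′ : ∀ a b → ℤ.- (ℤ.+ 1) ℤ.* a ℤ.+ b ≡ b ℤ.- a
  lem′ = solve-∀

sumAbove : (Subset n → ℤ) → Subset n → ℤ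
sumAbove F []            = F []
sumAbove F (inside  ∷ A) = sumAbove (F ∘ (inside ∷_)) A
sumAbove F (outside ∷ A) = sumAbove (F ∘ (inside ∷_)) A ℤ.+ sumAbove (F ∘ (outside ∷_)) A

sumAbove-cong : ∀ {F G : Subset n → ℤ} → (∀ I → F I ≡ G I) → ∀ A → sumAbove F A ≡ sumAbove G A
sumAbove-cong F≗G []            = F≗G []
sumAbove-cong F≗G (inside  ∷ A) = sumAbove-cong (F≗G ∘ (inside ∷_)) A
sumAbove-cong F≗G (outside ∷ A) = cong₂ ℤ._+_ (sumAbove-cong (F≗G ∘ (inside ∷_)) A) (sumAbove-cong (F≗G ∘ (outside ∷_)) A)

sumAbove-- : ∀ (F G : Subset n → ℤ) A → sumAbove (λ I → F I ℤ.- G I) A ≡ sumAbove F A ℤ.- sumAbove G A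
sumAbove-- F G []            = refl
sumAbove-- F G (inside  ∷ A) = sumAbove-- (F ∘ (inside ∷_)) (G ∘ (inside ∷_)) A
sumAbove-- F G (outside ∷ A) = trans
  (cong₂ ℤ._+_ (sumAbove-- (F ∘ (inside ∷_)) (G ∘ (inside ∷_)) A) (sumAbove-- (F ∘ (outside ∷_)) (G ∘ (outside ∷_)) A))
  (lem (sumAbove (F ∘ (inside ∷_)) A) (sumAbove (G ∘ (inside ∷_)) A) (sumAbove (F ∘ (outside ∷_)) A) (sumAbove (G ∘ (outside ∷_)) A))
  where
  lem : ∀ a b c d → (a ℤ.- b) ℤ.+ (c ℤ.- d) ≡ (a ℤ.+ c) ℤ.- (b ℤ.+ d)
  lem = solve-∀

-- One coordinate at a time: where A omits an element, the sets containing it contribute the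
-- transform of `hᵢ`, the others that of `hₒ` minus that of `hᵢ`, and the former cancels.
möbius-inversion : ∀ (h : Subset n → ℤ) A → sumAbove (möbius h) A ≡ h A
möbius-inversion h []            = trans (ℤ.+-identityʳ _) (ℤ.*-identityˡ (h []))
möbius-inversion h (inside  ∷ A) = trans (sumAbove-cong (möbius-inside h) A) (möbius-inversion (h ∘ (inside ∷_)) A)
möbius-inversion h (outside ∷ A) = begin
  sumAbove (möbius h ∘ (inside ∷_)) A ℤ.+ sumAbove (möbius h ∘ (outside ∷_)) A
    ≡⟨ cong₂ ℤ._+_ (sumAbove-cong (möbius-inside h) A) (trans (sumAbove-cong (möbius-outside h) A) (sumAbove-- (möbius hₒ) (möbius hᵢ) A)) ⟩
  sumAbove (möbius hᵢ) A ℤ.+ (sumAbove (möbius hₒ) A ℤ.- sumAbove (möbius hᵢ) A)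
    ≡⟨ lem (sumAbove (möbius hᵢ) A) (sumAbove (möbius hₒ) A) ⟩
  sumAbove (möbius hₒ) A
    ≡⟨ möbius-inversion hₒ A ⟩
  h (outside ∷ A) ∎
  where
  open ≡-Reasoning
  hᵢ = h ∘ (inside ∷_)
  hₒ = h ∘ (outside ∷_)
  lem : ∀ a b → a ℤ.+ (b ℤ.- a) ≡ b
  lem = solve-∀

sumℤ-allSubsets : ∀ (F : Subset (suc n) → ℤ) →
  sumℤ F (allSubsets (suc n)) ≡ sumℤ (F ∘ (inside ∷_)) (allSubsets n) ℤ.+ sumℤ (F ∘ (outside ∷_)) (allSubsets n)
sumℤ-allSubsets {n} F = trans (sumℤ-++ F (map (inside ∷_) (allSubsets n)) (map (outside ∷_) (allSubsets n)))
  (cong₂ ℤ._+_ (sumℤ-map F (inside ∷_) (allSubsets n)) (sumℤ-map F (outside ∷_) (allSubsets n)))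

sumAbove-⊥ : ∀ (F : Subset n → ℤ) → sumℤ F (allSubsets n) ≡ sumAbove F ⊥
sumAbove-⊥ {zero}  F = ℤ.+-identityʳ (F [])
sumAbove-⊥ {suc n} F = trans (sumℤ-allSubsets F) (cong₂ ℤ._+_ (sumAbove-⊥ (F ∘ (inside ∷_))) (sumAbove-⊥ (F ∘ (outside ∷_))))

-- A meets the complement of I exactly when I does not contain A, so the sets containing A are
-- removed from the total. `meets` and `∁` compute coordinatewise, in step with `allSubsets`.
sumNotAbove : ∀ (F : Subset n → ℤ) A →
  sumℤ (λ I → if meets A (∁ I) then F I else ℤ.+ 0) (allSubsets n) ≡ sumAbove F ⊥ ℤ.- sumAbove F A
sumNotAbove F [] = sym (ℤ.+-inverseʳ (F []))
sumNotAbove {suc n} F (s ∷ A) = trans (sumℤ-allSubsets (λ I → if meets (s ∷ A) (∁ I) then F I else ℤ.+ 0)) (halves s)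
  where
  Fᵢ = F ∘ (inside ∷_)
  Fₒ = F ∘ (outside ∷_)
  lemᵢ : ∀ a b c → (a ℤ.- b) ℤ.+ c ≡ (a ℤ.+ c) ℤ.- b
  lemᵢ = solve-∀
  lemₒ : ∀ a b c d → (a ℤ.- b) ℤ.+ (c ℤ.- d) ≡ (a ℤ.+ c) ℤ.- (b ℤ.+ d)
  lemₒ = solve-∀
  halves : ∀ s →
    sumℤ (λ I → if meets (s ∷ A) (∁ (inside ∷ I)) then Fᵢ I else ℤ.+ 0) (allSubsets n)
      ℤ.+ sumℤ (λ I → if meets (s ∷ A) (∁ (outside ∷ I)) then Fₒ I else ℤ.+ 0) (allSubsets n)
    ≡ sumAbove F ⊥ ℤ.- sumAbove F (s ∷ A)
  -- A set I that omits this element of A cannot contain A, so the second half is an unrestricted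
  -- sum.
  halves inside = trans (cong₂ ℤ._+_ (sumNotAbove Fᵢ A) (sumAbove-⊥ Fₒ)) (lemᵢ (sumAbove Fᵢ ⊥) (sumAbove Fᵢ A) (sumAbove Fₒ ⊥))
  halves outside = trans (cong₂ ℤ._+_ (sumNotAbove Fᵢ A) (sumNotAbove Fₒ A))
    (lemₒ (sumAbove Fᵢ ⊥) (sumAbove Fᵢ A) (sumAbove Fₒ ⊥) (sumAbove Fₒ A))

-- Agreement of the set functions

telescope : ∀ m (g u : ℕ → ℤ) → (∀ j → g j ℤ.+ u j ≡ u (suc j)) →
  sumFin m (λ k → ι (g (toℕ k))) + ι (u 0) ≡ ι (u m)
telescope zero    g u step = ℚ.+-identityˡ (ι (u 0))
telescope (suc m) g u step = begin
  (ι (g 0) + rest) + ι (u 0)   ≡⟨ solve 3 (λ a b c → (a :+ b) :+ c := b :+ (a :+ c)) refl (ι (g 0)) rest (ι (u 0)) ⟩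
  rest + (ι (g 0) + ι (u 0))   ≡⟨ cong (rest +_) (trans (sym (ι-+ (g 0) (u 0))) (cong ι (step 0))) ⟩
  rest + ι (u 1)               ≡⟨ telescope m (g ∘ suc) (u ∘ suc) (step ∘ suc) ⟩
  ι (u (suc m))                ∎
  where
  open ≡-Reasoning
  rest = sumFin m (λ k → ι (g (suc (toℕ k))))

module _ (M : Matroid n) where

  -- The partial sum of min(k, a) over 1 ≤ k ≤ j is tri(j) - tri(j ∸ a). Truncated subtraction lets
  -- one formula cover j ≤ a, where the second term vanishes, and j > a.
  cappedRank-tri : ∀ A → cappedRank M A ≡ ι (ℤ.+ tri (rank M) ℤ.- ℤ.+ tri (rank M ∸ rk M A))
  cappedRank-tri A = trans (sym (ℚ.+-identityʳ (cappedRank M A)))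
    (trans (cong (λ z → cappedRank M A + ι z) (sym u0≡0)) (telescope (rank M) (λ j → ℤ.+ (suc j ⊓ a)) u step))
    where
    a = rk M A
    u : ℕ → ℤ
    u j = ℤ.+ tri j ℤ.- ℤ.+ tri (j ∸ a)
    u0≡0 : u 0 ≡ ℤ.+ 0
    u0≡0 = cong (λ m → ℤ.+ 0 ℤ.- ℤ.+ tri m) (ℕ.0∸n≡0 a)
    lem : ∀ a d t t′ → a ℤ.+ (t ℤ.- t′) ≡ ((ℤ.+ 1 ℤ.+ (a ℤ.+ d)) ℤ.+ t) ℤ.- ((ℤ.+ 1 ℤ.+ d) ℤ.+ t′)
    lem = solve-∀
    step : ∀ j → ℤ.+ (suc j ⊓ a) ℤ.+ u j ≡ u (suc j)
    step j with ℕ.≤-<-connex a j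
    ... | inj₁ a≤j rewrite ℕ.m≥n⇒m⊓n≡n (ℕ.m≤n⇒m≤1+n a≤j) | ℕ.+-∸-assoc 1 a≤j =
      trans (lem (ℤ.+ a) (ℤ.+ (j ∸ a)) (ℤ.+ tri j) (ℤ.+ tri (j ∸ a)))
        (cong (λ z → ((ℤ.+ 1 ℤ.+ ℤ.+ z) ℤ.+ ℤ.+ tri j) ℤ.- ℤ.+ tri (suc (j ∸ a))) (ℕ.m+[n∸m]≡n a≤j))
    ... | inj₂ j<a rewrite ℕ.m≤n⇒m⊓n≡m j<a | ℕ.m≤n⇒m∸n≡0 j<a | ℕ.m≤n⇒m∸n≡0 (ℕ.<⇒≤ j<a) =
      sym (ℤ.+-assoc (ℤ.+ suc j) (ℤ.+ tri j) (ℤ.+ 0))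

  corankTri : Subset n → ℤ
  corankTri A = ℤ.+ tri (rank M ∸ rk M A)

  -- The corank of A in M/I is r - r(A ∪ I), because r(I) cancels. So the summands for all
  -- contractions come from the single function `corankTri` at A ∪ I.
  signedGamma-möbius : ∀ I → signedGamma (contract M I) ≡ möbius corankTri I
  signedGamma-möbius I = trans (signedGamma-sum (contract M I) ≤R ≤∣∣)
    (sumℤ-cong (λ A → cong (λ m → sign ∣ A ∣ ℤ.* ℤ.+ tri m) (differ A)) (subsetsOf (∁ I)))
    where
    ∁I∪I≡⊤ : ∁ I ∪ I ≡ ⊤
    ∁I∪I≡⊤ = trans (∪-comm (∁ I) I) (p∪∁p≡⊤ I)
    ≤R : ∀ A → rk M (A ∪ I) ∸ rk M I ℕ.≤ rk M (∁ I ∪ I) ∸ rk M I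
    ≤R A = ℕ.∸-monoˡ-≤ (rk M I) (rk-mono M (λ {j} _ → subst (j ∈_) (sym ∁I∪I≡⊤) ∈⊤))
    ≤∣∣ : ∀ A → rk M (A ∪ I) ∸ rk M I ℕ.≤ ∣ A ∣
    ≤∣∣ A = ℕ.≤-trans (ℕ.∸-monoˡ-≤ (rk M I) (rk-∪ M A I))
      (ℕ.≤-trans (ℕ.≤-reflexive (ℕ.m+n∸n≡m (rk M A) (rk M I))) (rk-bound M A))
    differ : ∀ A → (rk M (∁ I ∪ I) ∸ rk M I) ∸ (rk M (A ∪ I) ∸ rk M I) ≡ rank M ∸ rk M (A ∪ I)
    differ A = trans (ℕ.∸-+-assoc (rk M (∁ I ∪ I)) (rk M I) _)
      (cong₂ _∸_ (cong (rk M) ∁I∪I≡⊤) (ℕ.m+[n∸m]≡n (rk-mono M (q⊆p∪q A I))))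

  γ̃ : Subset n → ℤ
  γ̃ I = signedGamma (contract M I)

  sum-γ̃ : ∀ A → ι (sumℤ (λ I → if meets A (∁ I) then γ̃ I else ℤ.+ 0) (properSubsets n)) ≡ cappedRank M A
  sum-γ̃ A = begin
    ι (sumℤ g (properSubsets n))
      -- The set I = E, absent from `properSubsets`, contributes 0 since no A meets its empty
      -- complement.
      ≡⟨ cong ι (sumℤ-filter (λ I → nonempty? (∁ I)) g vanish (allSubsets n)) ⟩
    ι (sumℤ g (allSubsets n))
      ≡⟨ cong ι (sumNotAbove γ̃ A) ⟩
    ι (sumAbove γ̃ ⊥ ℤ.- sumAbove γ̃ A)
      ≡⟨ cong ι (cong₂ ℤ._-_ (above ⊥) (above A)) ⟩
    ι (corankTri ⊥ ℤ.- corankTri A)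
      ≡⟨ cong (λ r → ι (ℤ.+ tri (rank M ∸ r) ℤ.- corankTri A)) (rk-⊥ M) ⟩
    ι (ℤ.+ tri (rank M) ℤ.- corankTri A)
      ≡⟨ cappedRank-tri A ⟨
    cappedRank M A ∎
    where
    open ≡-Reasoning
    g = λ I → if meets A (∁ I) then γ̃ I else ℤ.+ 0
    vanish : ∀ I → ¬ Nonempty (∁ I) → g I ≡ ℤ.+ 0
    vanish I empty with meets A (∁ I) in eq
    ... | false = refl
    ... | true  = let i , _ , i∈ = meets⇒∈ A (∁ I) eq in ⊥-elim (empty (i , i∈))
    above : ∀ A → sumAbove γ̃ A ≡ corankTri A
    above A = trans (sumAbove-cong signedGamma-möbius A) (möbius-inversion corankTri A)

-- Positive and negative parts, and the conclusion

0≤posPart : ∀ z → 0ℚ ≤ posPart z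
0≤posPart (ℤ.+ k)    = 0≤ι+ k
0≤posPart ℤ.-[1+ k ] = ℚ.≤-refl

0≤negPart : ∀ z → 0ℚ ≤ negPart z
0≤negPart (ℤ.+ k)    = ℚ.≤-refl
0≤negPart ℤ.-[1+ k ] = 0≤ι+ (suc k)

posPart-negPart : ∀ z → posPart z ≡ ι z + negPart z
posPart-negPart (ℤ.+ k)    = sym (ℚ.+-identityʳ (ι (ℤ.+ k)))
posPart-negPart ℤ.-[1+ k ] = trans (cong ι (sym (ℤ.+-inverseˡ (ℤ.+ suc k)))) (ι-+ ℤ.-[1+ k ] (ℤ.+ suc k))

posPart-sum : ∀ {X : Set} (z : X → ℤ) (b : X → Bool) xs →
  sumℚ (λ x → posPart (z x) * (if b x then 1ℚ else 0ℚ)) xs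
  ≡ ι (sumℤ (λ x → if b x then z x else ℤ.+ 0) xs) + sumℚ (λ x → negPart (z x) * (if b x then 1ℚ else 0ℚ)) xs
posPart-sum z b []       = refl
posPart-sum z b (x ∷ xs) = begin
  posPart (z x) * c + sumℚ _ xs
    ≡⟨ cong₂ _+_ (split (b x)) (posPart-sum z b xs) ⟩
  (ι y + negPart (z x) * c) + (ι Σz + Σn)
    ≡⟨ +-interchange (ι y) (negPart (z x) * c) (ι Σz) Σn ⟩
  (ι y + ι Σz) + (negPart (z x) * c + Σn)
    ≡⟨ cong (_+ (negPart (z x) * c + Σn)) (sym (ι-+ y Σz)) ⟩
  ι (y ℤ.+ Σz) + (negPart (z x) * c + Σn) ∎
  where
  open ≡-Reasoning
  c = if b x then 1ℚ else 0ℚ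
  y = if b x then z x else ℤ.+ 0
  Σz = sumℤ (λ x → if b x then z x else ℤ.+ 0) xs
  Σn = sumℚ (λ x → negPart (z x) * (if b x then 1ℚ else 0ℚ)) xs
  split : ∀ b → posPart (z x) * (if b then 1ℚ else 0ℚ) ≡ ι (if b then z x else ℤ.+ 0) + negPart (z x) * (if b then 1ℚ else 0ℚ)
  split true  = trans (ℚ.*-identityʳ _) (trans (posPart-negPart (z x)) (cong (ι (z x) +_) (sym (ℚ.*-identityʳ (negPart (z x))))))
  split false = trans (ℚ.*-zeroʳ (posPart (z x))) (sym (trans (ℚ.+-identityˡ _) (ℚ.*-zeroʳ (negPart (z x)))))

sum-submodular : ∀ {X : Set} {f : X → Subset n → ℚ} → (∀ x → Submodular (f x)) → ∀ xs → Submodular (λ A → sumℚ (λ x → f x A) xs)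
sum-submodular sub []       A B = ℚ.≤-refl
sum-submodular {f = f} sub (x ∷ xs) A B = subst₂ _≤_
  (+-interchange (f x (A ∪ B)) (f x (A ∩ B)) (Σf (A ∪ B)) (Σf (A ∩ B)))
  (+-interchange (f x A) (f x B) (Σf A) (Σf B))
  (ℚ.+-mono-≤ (sub x A B) (sum-submodular sub xs A B))
  where Σf = λ A → sumℚ (λ x → f x A) xs

*-submodular : ∀ {f : Subset n → ℚ} {y} → 0ℚ ≤ y → Submodular f → Submodular (λ A → y * f A)
*-submodular {f = f} {y} 0≤y sub A B = subst₂ _≤_ (ℚ.*-distribˡ-+ y (f (A ∪ B)) (f (A ∩ B))) (ℚ.*-distribˡ-+ y (f A) (f B))
  (ℚ.*-monoˡ-≤-nonNeg y {{nonNegative 0≤y}} (sub A B))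

sum-covers-⊥ : ∀ {X : Set} (y : X → ℚ) (J : X → Subset n) xs → sumℚ (λ x → y x * cover (J x) ⊥) xs ≡ 0ℚ
sum-covers-⊥ y J []       = refl
sum-covers-⊥ y J (x ∷ xs) = cong₂ _+_ (trans (cong (y x *_) (cover-⊥ (J x))) (ℚ.*-zeroʳ (y x))) (sum-covers-⊥ y J xs)

simplexSum-realizes : ∀ (y : Subset n → ℚ) → (∀ I → 0ℚ ≤ y I) →
  Realizes (minkSum (map (λ I → scale (y I) (simplex (∁ I))) (properSubsets n)))
           (λ A → sumℚ (λ I → y I * cover (∁ I) A) (properSubsets n))
simplexSum-realizes {n} y 0≤y = minkSum-map-realizes _ (λ I A → y I * cover (∁ I) A)
  (All.map (λ {I} ne → scale-realizes (0≤y I) (simplex-realizes ne)) (all-filter (λ I → nonempty? (∁ I)) (allSubsets n)))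

theorem5p4 : (n : ℕ) (M : Matroid n) (p : Pt n) →
    minkSum (flagPolytope M ∷ negativeTerms M) p ⇔ minkSum (positiveTerms M) p
theorem5p4 n M = realizes⇒⇔
  (minkSum-∷-realizes (flagPolytope-realizes M) (simplexSum-realizes (negPart ∘ γ̃ M) (0≤negPart ∘ γ̃ M)))
  (simplexSum-realizes (posPart ∘ γ̃ M) (0≤posPart ∘ γ̃ M))
  (λ A → sym (trans (posPart-sum (γ̃ M) (λ I → meets A (∁ I)) (properSubsets n))
    (cong (_+ sumℚ (λ I → negPart (γ̃ M I) * cover (∁ I) A) (properSubsets n)) (sum-γ̃ M A))))
  -- Submodularity is checked on the positive side, a nonnegative combination of functions of
  -- simplices.
  (sum-submodular (λ I → *-submodular (0≤posPart (γ̃ M I)) (cover-submodular (∁ I))) (properSubsets n))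
  (sum-covers-⊥ (posPart ∘ γ̃ M) ∁ (properSubsets n))
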